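{- Let $k$ be an odd prime and $\lambda$ a partition. Suppose that $m_{\lambda,\nu}=\delta_{\lambda,\nu}$ for all partitions $\nu$ of $|\lambda|$ (equivalently, $\mathfrak s^{(k)}_\lambda=s_\lambda$). Then $\lambda$ is a $k$-core.
   Context: The Petrie symmetric functions $G(k,m)$ are defined by $\sum_{m\ge0}G(k,m)(X)z^m=\prod_{i\ge1}\sum_{j=0}^{k-1}(x_iz)^j$, with $G(k,m)=0$ for $m<0$. The modular Schur function is $\mathfrak s^{(k)}_\lambda(X)=\det_{1\le i,j\le\ell(\lambda)}\bigl(G(k,\lambda_i-i+j)(X)\bigr)$, and the coefficients $m_{\lambda,\nu}$ are defined by $\mathfrak s^{(k)}_\lambda=\sum_{\nu\vdash|\lambda|}m_{\lambda,\nu}\,s_\nu$, where $s_\nu$ are the Schur functions. A partition is a $k$-core if no ribbon with $k$ boxes can be removed from it; equivalently none of its hook lengths is divisible by $k$. -}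

module Defs where

open import Algebra.Bundles using (RawRing)
import Algebra.Definitions.RawSemiring as RawSemiringDefs
open import Data.Bool using (if_then_else_)
open import Data.Fin using (Fin; zero; suc; toℕ; punchIn)
open import Data.Integer as ℤ using (ℤ; 0ℤ; 1ℤ)
open import Data.List using (List; []; _∷_; map; foldr; filter; length; lookup; reverse; upTo; cartesianProductWith)
open import Data.List.Properties using (≡-dec)
open import Data.List.Relation.Unary.All using (All; all?)
open import Data.List.Relation.Unary.Linked using (Linked; linked?)
open import Data.Nat using (ℕ; zero; suc; _+_; _∸_; _≤_; _<_; _≥_; _≟_; _≤?_; _<?_; _≥?_)
open import Data.Nat.ListAction using (sum)
open import Data.Product using (_×_; _,_)
open import Data.Sum using (_⊎_)
open import Level using (0ℓ)
open import Relation.Binary.Construct.Closure.Equivalence using (EqClosure)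
open import Relation.Binary.PropositionalEquality using (_≡_)
open import Relation.Nullary using (¬_; Dec; does)
open import Relation.Nullary.Decidable using (_×-dec_)

IsPartition : List ℕ → Set
IsPartition ν = Linked _≥_ ν × All (0 <_) ν

_⊢_ : List ℕ → ℕ → Set
ν ⊢ n = IsPartition ν × sum ν ≡ n

_⊢?_ : ∀ ν n → Dec (ν ⊢ n)
ν ⊢? n = (linked? _≥?_ ν ×-dec all? (0 <?_) ν) ×-dec (sum ν ≟ n)

words : {A : Set} → ℕ → List A → List (List A)
words zero    xs = [] ∷ []
words (suc n) xs = [] ∷ cartesianProductWith _∷_ xs (words n xs)

-- A partition of n has at most n parts, each of them at most n.
partitions : ℕ → List (List ℕ)
partitions n = filter (_⊢? n) (words n (upTo (suc n)))

δ : List ℕ → List ℕ → ℤ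
δ ν ρ = if does (≡-dec _≟_ ν ρ) then 1ℤ else 0ℤ

part : List ℕ → ℕ → ℕ
part []      _       = 0
part (a ∷ _) zero    = a
part (_ ∷ ν) (suc i) = part ν i

-- Cells are (row , column), both counted from 0.
Cell : Set
Cell = ℕ × ℕ

_∈_/_ : Cell → List ℕ → List ℕ → Set
(i , j) ∈ ν / ρ = part ρ i ≤ j × j < part ν i

-- The second cell is immediately to the right of, or below, the first.
Next : Cell → Cell → Set
Next (i , j) (i′ , j′) = (i′ ≡ i × j′ ≡ suc j) ⊎ (i′ ≡ suc i × j′ ≡ j)

Connected : List ℕ → List ℕ → Set
Connected ν ρ = ∀ c d → c ∈ ν / ρ → d ∈ ν / ρ →
  EqClosure (λ x y → x ∈ ν / ρ × y ∈ ν / ρ × Next x y) c d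

No2×2 : List ℕ → List ℕ → Set
No2×2 ν ρ = ∀ i j → ¬ ((i , j) ∈ ν / ρ × (i , suc j) ∈ ν / ρ
                      × (suc i , j) ∈ ν / ρ × (suc i , suc j) ∈ ν / ρ)

record RibbonRemoval (k : ℕ) (ν ρ : List ℕ) : Set where
  field
    isPartition : IsPartition ρ
    contained   : ∀ i → part ρ i ≤ part ν i
    size        : sum ν ≡ k + sum ρ
    connected   : Connected ν ρ
    no2×2       : No2×2 ν ρ

IsCore : ℕ → List ℕ → Set
IsCore k ν = ∀ ρ → ¬ RibbonRemoval k ν ρ

-- Formal power series with integer coefficients in x₀, x₁, x₂, …:
-- f (a₀ ∷ … ∷ aₙ₋₁ ∷ []) is the coefficient of x₀^a₀ ⋯ xₙ₋₁^aₙ₋₁.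
-- Appending zeros to a list of exponents does not change the monomial.

Series : Set
Series = List ℕ → ℤ

0ˢ : Series
0ˢ _ = 0ℤ

1ˢ : Series
1ˢ α = if does (sum α ≟ 0) then 1ℤ else 0ℤ

infixl 6 _+ˢ_
infixl 7 _*ˢ_ _•_

_+ˢ_ : Series → Series → Series
(f +ˢ g) α = f α ℤ.+ g α

-ˢ_ : Series → Series
(-ˢ f) α = ℤ.- f α

_•_ : ℤ → Series → Series
(c • f) α = c ℤ.* f α

-- The Cauchy product, one variable at a time.
_*ˢ_ : Series → Series → Series
(f *ˢ g) []      = f [] ℤ.* g []
(f *ˢ g) (a ∷ α) =
  foldr ℤ._+_ 0ℤ (map (λ i → ((λ β → f (i ∷ β)) *ˢ (λ β → g (a ∸ i ∷ β))) α) (upTo (suc a)))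

seriesRing : RawRing 0ℓ 0ℓ
seriesRing = record
  { Carrier = Series
  ; _≈_     = λ f g → ∀ α → f α ≡ g α
  ; _+_     = _+ˢ_
  ; _*_     = _*ˢ_
  ; -_      = -ˢ_
  ; 0#      = 0ˢ
  ; 1#      = 1ˢ
  }

var : ℕ → Series
var _       []      = 0ℤ
var zero    (a ∷ α) = if does (a ≟ 1) then 1ˢ α else 0ℤ
var (suc i) (a ∷ α) = if does (a ≟ 0) then var i α else 0ℤ

-- Laplace expansion along the first row.
module _ {c ℓ} (R : RawRing c ℓ) where
  open RawRing R renaming (_+_ to _+ᴿ_; _*_ to _*ᴿ_)
  open RawSemiringDefs rawSemiring using (_^_) renaming (sum to ∑)

  det : ∀ n → (Fin n → Fin n → Carrier) → Carrier
  det zero    A = 1#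
  det (suc n) A =
    ∑ λ j → (- 1#) ^ toℕ j *ᴿ (A zero j *ᴿ det n (λ r s → A (suc r) (punchIn j s)))

open RawRing seriesRing using (rawSemiring)
open RawSemiringDefs rawSemiring using (_^_) renaming (sum to ∑; product to ∏)

-- ∏_{i < n} ∑_{j < k} (xᵢ z)^j, where z is variable 0 and xᵢ is variable suc i.
petrieGen : (k n : ℕ) → Series
petrieGen k n = ∏ λ (i : Fin n) → ∑ λ (j : Fin k) → (var (suc (toℕ i)) *ˢ var 0) ^ toℕ j

-- The coefficient of z^m in the infinite product: factors whose x-variable does
-- not occur in x^α contribute only their constant term 1 to the coefficient of x^α.
-- (For k = 0 there is no such term; the definition is meant for k ≥ 1.)
petrie : ℕ → ℕ → Series
petrie k m α = petrieGen k (length α) (m ∷ α)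

petrieℤ : ℕ → ℤ → Series
petrieℤ k (ℤ.+ m)    = petrie k m
petrieℤ k ℤ.-[1+ _ ] = 0ˢ

modularSchur : ℕ → List ℕ → Series
modularSchur k ν = det seriesRing (length ν) λ i j →
  petrieℤ k (ℤ.+ lookup ν i ℤ.- ℤ.+ toℕ i ℤ.+ ℤ.+ toℕ j)

-- Schur functions, as generating functions of semistandard tableaux.  A tableau
-- of shape ν is a chain ∅ = ν⁽⁰⁾ ⊆ ν⁽¹⁾ ⊆ ⋯ ⊆ ν⁽ⁿ⁾ = ν in which every
-- ν⁽ⁱ⁾ / ν⁽ⁱ⁻¹⁾, the set of cells with entry i, is a horizontal strip.

-- All ρ for which ν / ρ is a horizontal strip, i.e. ν₁ ≥ ρ₁ ≥ ν₂ ≥ ρ₂ ≥ ⋯.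
-- The results have the same length as ν, so they may end in zeros.
horizontalStrips : List ℕ → List (List ℕ)
horizontalStrips []      = [] ∷ []
horizontalStrips (a ∷ ν) =
  cartesianProductWith _∷_ (filter (part ν 0 ≤?_) (upTo (suc a))) (horizontalStrips ν)

-- The number of tableaux of shape ν whose weight, listed from the largest entry
-- down to the smallest, is the second argument.
countTableaux : List ℕ → List ℕ → ℕ
countTableaux ν []      = if does (sum ν ≟ 0) then 1 else 0
countTableaux ν (a ∷ α) =
  sum (map (λ ρ → countTableaux ρ α) (filter (λ ρ → a + sum ρ ≟ sum ν) (horizontalStrips ν)))

schur : List ℕ → Series
schur ν α = ℤ.+ countTableaux ν (reverse α)

-- m is the family of coefficients of the modular Schur function of ν in the
-- basis of Schur functions; only its values on partitions of |ν| matter.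
IsSchurExpansion : ℕ → List ℕ → (List ℕ → ℤ) → Set
IsSchurExpansion k ν m = modularSchur k ν ≈
    foldr _+ˢ_ 0ˢ (map (λ ρ → m ρ • schur ρ) (partitions (sum ν)))
  where open RawRing seriesRing using (_≈_)

{-# OPTIONS --safe #-}
module Submission where

-- Let φ send h_m to G(k,m); it multiplies the power sum p_n by 1 when k ∤ n and by
-- 1 - k when k ∣ n, so the adjoint of multiplication by p_k satisfies
-- p_k^⊥ φ = (1 - k) φ p_k^⊥.  If φ(s_λ) = s_λ, all coefficients of p_k^⊥ s_λ are
-- therefore divisible by k - 1 ≥ 2.  But p_k^⊥ s_λ is the sum of ± s_μ over the
-- distinct μ obtained by removing a k-ribbon from λ; the coefficient of x^μ for the
-- lexicographically largest such μ is ± 1, so there is no such μ.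
--
-- Everything is computed on coefficients: the variables are split off one at a time,
-- and each acts on vectors of first-column hook lengths by lowering their entries.

open import Defs
open import Algebra.Bundles using (RawRing)
import Algebra.Definitions.RawSemiring as RawSemiringDefs
open import Data.Bool using (Bool; true; false; if_then_else_)
open import Data.Fin using (Fin; zero; suc; toℕ; punchIn)
import Data.Fin.Properties as Finₚ
open import Data.Integer using (ℤ; 0ℤ; 1ℤ; -[1+_]; _⊖_; ∣_∣)
  renaming (_+_ to _+ℤ_; _*_ to _*ℤ_; -_ to -ℤ_; +_ to pos; _-_ to _-ℤ_)
import Data.Integer.Properties as ℤₚ
open import Data.Integer.Tactic.RingSolver using (solve-∀)
open import Data.List using
  ( List; []; _∷_; _++_; [_]; reverse; foldr; map; filter; length; lookup; tabulate
  ; upTo; applyUpTo; downFrom; cartesianProductWith)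
open import Data.List.Membership.Propositional using (_∈_; _∉_)
import Data.List.Membership.Propositional.Properties as ∈ₚ
import Data.List.Properties as Listₚ
open import Data.List.Relation.Unary.All as All using (All; []; _∷_)
import Data.List.Relation.Unary.All.Properties as Allₚ
open import Data.List.Relation.Unary.AllPairs using ([]; _∷_)
open import Data.List.Relation.Unary.Any using (here; there)
open import Data.List.Relation.Unary.Linked using (Linked; []; [-]; _∷_)
open import Data.List.Relation.Unary.Unique.Propositional using (Unique)
import Data.List.Relation.Unary.Unique.Propositional.Properties as Uniqueₚ
open import Data.Nat using
  (ℕ; zero; suc; _+_; _∸_; _≤_; _<_; _≥_; z≤n; s≤s; _≤?_; _<?_; _≟_; nonTrivial⇒n>1)
open import Data.Nat.Divisibility using (_∣_; divides)
open import Data.Nat.Induction using (<-rec)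
open import Data.Nat.ListAction using (sum)
open import Data.Nat.Primality using (Prime; prime)
import Data.Nat.Properties as ℕₚ
open import Data.List.Membership.DecPropositional _≟_ using (_∈?_)
open import Data.Nat.Solver using (module +-*-Solver)
open import Data.Product using (_×_; _,_; proj₁; proj₂; ∃)
open import Data.Sum using (_⊎_; inj₁; inj₂)
open import Data.Unit using (⊤; tt)
open import Function using (_∘_)
open import Relation.Binary using (tri<; tri≈; tri>)
import Relation.Binary.Construct.Closure.Equivalence as EqClosureₚ
open import Relation.Binary.PropositionalEquality
  using (_≡_; _≢_; refl; sym; trans; cong; cong₂; subst; isEquivalence; module ≡-Reasoning)
open import Relation.Nullary using (¬_; yes; no; does; contradiction)
open import Relation.Nullary.Decidable using (dec-true; dec-false)
open import Algebra.Properties.AbelianGroup ℤₚ.+-0-abelianGroup using () renaming (∙-cancelˡ to +ℤ-cancelˡ)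

open +-*-Solver using (solve; con; _:+_; _:=_)
open ≡-Reasoning
open RawRing seriesRing using (rawSemiring)
open RawSemiringDefs rawSemiring using (_^_) renaming (sum to ∑; product to ∏)

-- Neither the ring of symmetric functions nor `φ` is constructed. Since `G(k,m)(x,Y)` is the sum of
-- `x^i G(k,m-i)(Y)` over `i < k`, splitting a variable off the determinant lowers its row indices
-- independently of each other, in a way governed only by the series `W(z) = ∑ w j z^j`. Schur
-- functions (`W = 1/(1 - z)`) and modular Schur functions (`W = (1 - z^k)/(1 - z)`) thus become two
-- instances of one recursion `E` with the same constant terms. In this picture `p_n^⊥` is the
-- operator `P n`, and the factor `1 - k` is the coefficient of `z^k` in `z W′(z)/W(z)`. Newton's
-- identities are solved for the power sums and not for the complete functions, so no division
-- occurs. The price is that `E` is evaluated at unsorted vectors and at vectors with repeated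
-- entries. Its antisymmetry deals with these: it yields the cancellations behind Pieri's rule for
-- tableaux, and it straightens the vectors that arise from lowering an entry by `k`.

private
  variable
    A B C : Set

-- Convolution sums, linear functionals and shifts

-- ∑_{i + j = n} F i j
anti : ℕ → (ℕ → ℕ → ℤ) → ℤ
anti zero    F = F 0 0
anti (suc n) F = F 0 (suc n) +ℤ anti n (λ i j → F (suc i) j)

anti-cong : ∀ n {F G : ℕ → ℕ → ℤ} → (∀ i j → i + j ≡ n → F i j ≡ G i j) → anti n F ≡ anti n G
anti-cong zero    eq = eq 0 0 refl
anti-cong (suc n) eq = cong₂ _+ℤ_ (eq 0 (suc n) refl) (anti-cong n λ i j e → eq (suc i) j (cong suc e))

+ℤ-interchange : ∀ a b c d → (a +ℤ b) +ℤ (c +ℤ d) ≡ (a +ℤ c) +ℤ (b +ℤ d)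
+ℤ-interchange = solve-∀

*ℤ-swap : ∀ a b c → a *ℤ (b *ℤ c) ≡ b *ℤ (a *ℤ c)
*ℤ-swap = solve-∀

anti-+ : ∀ n (F G : ℕ → ℕ → ℤ) → anti n (λ i j → F i j +ℤ G i j) ≡ anti n F +ℤ anti n G
anti-+ zero    F G = refl
anti-+ (suc n) F G =
  trans (cong (F 0 (suc n) +ℤ G 0 (suc n) +ℤ_) (anti-+ n (λ i → F (suc i)) (λ i → G (suc i))))
        (+ℤ-interchange (F 0 (suc n)) _ _ _)

anti-* : ∀ n c (F : ℕ → ℕ → ℤ) → anti n (λ i j → c *ℤ F i j) ≡ c *ℤ anti n F
anti-* zero    c F = refl
anti-* (suc n) c F =
  trans (cong (c *ℤ F 0 (suc n) +ℤ_) (anti-* n c (λ i → F (suc i))))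
        (sym (ℤₚ.*-distribˡ-+ c (F 0 (suc n)) _))

anti-0 : ∀ n → anti n (λ _ _ → 0ℤ) ≡ 0ℤ
anti-0 n = anti-* n 0ℤ (λ _ _ → 0ℤ)

anti-last : ∀ n (F : ℕ → ℕ → ℤ) → anti (suc n) F ≡ anti n (λ i j → F i (suc j)) +ℤ F (suc n) 0
anti-last zero    F = refl
anti-last (suc n) F =
  trans (cong (F 0 (suc (suc n)) +ℤ_) (anti-last n (λ i → F (suc i))))
        (sym (ℤₚ.+-assoc (F 0 (suc (suc n))) _ _))

anti-comm : ∀ n (F : ℕ → ℕ → ℤ) → anti n F ≡ anti n (λ i j → F j i)
anti-comm zero    F = refl
anti-comm (suc n) F =
  trans (anti-last n F) (trans (ℤₚ.+-comm _ (F (suc n) 0))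
    (cong (F (suc n) 0 +ℤ_) (anti-comm n (λ i j → F i (suc j)))))

anti-assoc : ∀ n (F : ℕ → ℕ → ℕ → ℤ) →
  anti n (λ i j → anti i (λ a b → F a b j)) ≡ anti n (λ a m → anti m (F a))
anti-assoc zero    F = refl
anti-assoc (suc n) F = begin
  F 0 0 (suc n) +ℤ anti n (λ i j → F 0 (suc i) j +ℤ anti i (λ a b → F (suc a) b j))
    ≡⟨ cong (F 0 0 (suc n) +ℤ_) (anti-+ n (λ i j → F 0 (suc i) j) _) ⟩
  F 0 0 (suc n) +ℤ (anti n (λ i j → F 0 (suc i) j) +ℤ anti n (λ i j → anti i (λ a b → F (suc a) b j)))
    ≡⟨ sym (ℤₚ.+-assoc (F 0 0 (suc n)) _ _) ⟩
  anti (suc n) (F 0) +ℤ anti n (λ i j → anti i (λ a b → F (suc a) b j))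
    ≡⟨ cong (anti (suc n) (F 0) +ℤ_) (anti-assoc n (λ a → F (suc a))) ⟩
  anti (suc n) (F 0) +ℤ anti n (λ a m → anti m (F (suc a))) ∎

anti-swap : ∀ n (F : ℕ → ℕ → ℕ → ℤ) →
  anti n (λ i r → anti r (F i)) ≡ anti n (λ j r → anti r (λ i → F i j))
anti-swap n F = begin
  anti n (λ i r → anti r (F i))                     ≡⟨ anti-assoc n F ⟨
  anti n (λ m s → anti m (λ i j → F i j s))         ≡⟨ anti-cong n (λ m s _ → anti-comm m (λ i j → F i j s)) ⟩
  anti n (λ m s → anti m (λ j i → F i j s))         ≡⟨ anti-assoc n (λ j i → F i j) ⟩
  anti n (λ j r → anti r (λ i → F i j))             ∎

anti-const : ∀ n → anti n (λ _ _ → 1ℤ) ≡ pos (suc n)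
anti-const zero    = refl
anti-const (suc n) = cong (1ℤ +ℤ_) (anti-const n)

-- The Leibniz rule for `z d/dz`, which multiplies the coefficient of `z^n` by `n = i + j`.
anti-weight : ∀ n (F : ℕ → ℕ → ℤ) →
  pos n *ℤ anti n F ≡ anti n (λ i j → pos i *ℤ F i j) +ℤ anti n (λ i j → pos j *ℤ F i j)
anti-weight n F = begin
  pos n *ℤ anti n F                                       ≡⟨ anti-* n (pos n) F ⟨
  anti n (λ i j → pos n *ℤ F i j)                         ≡⟨ anti-cong n (λ { i j refl → ℤₚ.*-distribʳ-+ (F i j) (pos i) (pos j) }) ⟩
  anti n (λ i j → pos i *ℤ F i j +ℤ pos j *ℤ F i j)       ≡⟨ anti-+ n _ _ ⟩
  anti n (λ i j → pos i *ℤ F i j) +ℤ anti n (λ i j → pos j *ℤ F i j) ∎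

-- Pointwise equal functions need not be provably equal, so `ext` is part of the notion. One
-- interface covers shifts, `U`, `P`, signed expansions and evaluations, and lets them pass through
-- each other.
record IsLinear (L : (A → ℤ) → ℤ) : Set where
  field
    ext   : ∀ {f g} → (∀ a → f a ≡ g a) → L f ≡ L g
    plus  : ∀ f g → L (λ a → f a +ℤ g a) ≡ L f +ℤ L g
    scale : ∀ c f → L (λ a → c *ℤ f a) ≡ c *ℤ L f

  null : L (λ _ → 0ℤ) ≡ 0ℤ
  null = scale 0ℤ (λ _ → 0ℤ)

  neg : ∀ f → L (λ a → -ℤ f a) ≡ -ℤ L f
  neg f = begin
    L (λ a → -ℤ f a)                ≡⟨ ext (λ a → sym (ℤₚ.-1*i≡-i (f a))) ⟩
    L (λ a → -ℤ 1ℤ *ℤ f a)          ≡⟨ scale (-ℤ 1ℤ) f ⟩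
    -ℤ 1ℤ *ℤ L f                    ≡⟨ ℤₚ.-1*i≡-i (L f) ⟩
    -ℤ L f                          ∎

  through-anti : ∀ n (F : ℕ → ℕ → A → ℤ) → L (λ a → anti n (λ i j → F i j a)) ≡ anti n (λ i j → L (F i j))
  through-anti zero    F = refl
  through-anti (suc n) F =
    trans (plus (F 0 (suc n)) _) (cong (L (F 0 (suc n)) +ℤ_) (through-anti n (λ i → F (suc i))))

open IsLinear

-- The shift operator x ↦ x - i, killing everything below 0.
sh : ℕ → ℕ → (ℕ → ℤ) → ℤ
sh zero    x       g = g x
sh (suc i) zero    g = 0ℤ
sh (suc i) (suc x) g = sh i x g

sh-linear : ∀ i x → IsLinear (sh i x)
sh-linear zero    x       = record { ext = λ e → e x ; plus = λ _ _ → refl ; scale = λ _ _ → refl }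
sh-linear (suc i) zero    = record
  { ext = λ _ → refl ; plus = λ _ _ → refl ; scale = λ c _ → sym (ℤₚ.*-zeroʳ c) }
sh-linear (suc i) (suc x) = sh-linear i x

sh-cong : ∀ i x {f g : ℕ → ℤ} → (∀ a → f a ≡ g a) → sh i x f ≡ sh i x g
sh-cong i x = ext (sh-linear i x)

sh-sh : ∀ i j x g → sh i x (λ x′ → sh j x′ g) ≡ sh (i + j) x g
sh-sh zero    j x       g = refl
sh-sh (suc i) j zero    g = refl
sh-sh (suc i) j (suc x) g = sh-sh i j x g

through-sh : ∀ {L : (A → ℤ) → ℤ} → IsLinear L → ∀ i x (F : ℕ → A → ℤ) →
  L (λ a → sh i x (λ x′ → F x′ a)) ≡ sh i x (λ x′ → L (F x′))
through-sh lin zero    x       F = refl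
through-sh lin (suc i) zero    F = null lin
through-sh lin (suc i) (suc x) F = through-sh lin i x F

-- Lowering operators on vectors

κ : ℕ → ℕ → ℤ
κ x y = if does (x ≟ y) then 1ℤ else 0ℤ

-- U w n is the coefficient of z^n in the operator ∏ᵢ ∑ⱼ w j (z Tᵢ)^j, where Tᵢ
-- lowers the i-th entry by 1.
U : (ℕ → ℤ) → ℕ → (List ℕ → ℤ) → List ℕ → ℤ
U w n f []      = κ n 0 *ℤ f []
U w n f (x ∷ v) = anti n (λ j r → w j *ℤ sh j x (λ x′ → U w r (λ d → f (x′ ∷ d)) v))

-- The power sum operator ∑ᵢ Tᵢ^n.
P : ℕ → (List ℕ → ℤ) → List ℕ → ℤ
P n f []      = 0ℤ
P n f (x ∷ v) = sh n x (λ x′ → f (x′ ∷ v)) +ℤ P n (λ d → f (x ∷ d)) v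

U-cong : ∀ w n b {f g : List ℕ → ℤ} → (∀ d → f d ≡ g d) → U w n f b ≡ U w n g b
U-cong w n []      e = cong (κ n 0 *ℤ_) (e [])
U-cong w n (x ∷ v) e = anti-cong n λ j r _ →
  cong (w j *ℤ_) (sh-cong j x λ x′ → U-cong w r v λ d → e (x′ ∷ d))

-- At a fixed vector, `U w n` is a finite integer combination of evaluations, and a linear
-- functional in an independent parameter passes through such a combination.
through-U : ∀ {L : (A → ℤ) → ℤ} → IsLinear L → ∀ w n b (F : List ℕ → A → ℤ) →
  L (λ a → U w n (λ d → F d a) b) ≡ U w n (λ d → L (F d)) b
through-U lin w n []      F = scale lin (κ n 0) (F [])
through-U {L = L} lin w n (x ∷ v) F = begin
  L (λ a → anti n (λ j r → w j *ℤ sh j x (λ x′ → U w r (λ d → F (x′ ∷ d) a) v)))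
    ≡⟨ through-anti lin n _ ⟩
  anti n (λ j r → L (λ a → w j *ℤ sh j x (λ x′ → U w r (λ d → F (x′ ∷ d) a) v)))
    ≡⟨ anti-cong n (λ j r _ → trans (scale lin (w j) _) (cong (w j *ℤ_)
         (trans (through-sh lin j x (λ x′ a → U w r (λ d → F (x′ ∷ d) a) v))
                (sh-cong j x λ x′ → through-U lin w r v (λ d → F (x′ ∷ d)))))) ⟩
  anti n (λ j r → w j *ℤ sh j x (λ x′ → U w r (λ d → L (F (x′ ∷ d))) v)) ∎


U-linear : ∀ w n b → IsLinear (λ f → U w n f b)
U-linear w n b = record { ext = U-cong w n b ; plus = λ f g → U-plus n b f g ; scale = λ c f → U-scale n b c f }
  where
  U-scale : ∀ n b c f → U w n (λ d → c *ℤ f d) b ≡ c *ℤ U w n f b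
  -- Scaling is a linear functional on families indexed by one point, addition one on families
  -- indexed by two (`Bool` below); both are thus cases of `through-U`.
  U-scale n b c f = sym (through-U {A = ⊤} (record
    { ext = λ e → cong (c *ℤ_) (e tt) ; plus = λ g h → ℤₚ.*-distribˡ-+ c (g tt) (h tt)
    ; scale = λ k g → *ℤ-swap c k (g tt) }) w n b (λ d _ → f d))

  U-plus : ∀ n b f g → U w n (λ d → f d +ℤ g d) b ≡ U w n f b +ℤ U w n g b
  U-plus n b f g = sym (through-U {A = Bool} (record
    { ext = λ e → cong₂ _+ℤ_ (e false) (e true) ; plus = λ g h → +ℤ-interchange (g false) (h false) _ _
    ; scale = λ k g → sym (ℤₚ.*-distribˡ-+ k (g false) _) }) w n b (λ d t → if t then g d else f d))

anti-linear : ∀ n → IsLinear (λ (F : ℕ × ℕ → ℤ) → anti n λ i j → F (i , j))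
anti-linear n = record
  { ext = λ e → anti-cong n λ i j _ → e (i , j) ; plus = λ F G → anti-+ n _ _ ; scale = λ c F → anti-* n c _ }

anti-anti : ∀ m n (F : ℕ → ℕ → ℕ → ℕ → ℤ) →
  anti m (λ i r → anti n (F i r)) ≡ anti n (λ j s → anti m (λ i r → F i r j s))
anti-anti m n F = through-anti (anti-linear m) n (λ j s ir → F (proj₁ ir) (proj₂ ir) j s)

U-0 : ∀ w → w 0 ≡ 1ℤ → ∀ f b → U w 0 f b ≡ f b
U-0 w w0 f []      = ℤₚ.*-identityˡ (f [])
U-0 w w0 f (x ∷ v) = trans (cong (_*ℤ U w 0 (λ d → f (x ∷ d)) v) w0)
  (trans (ℤₚ.*-identityˡ _) (U-0 w w0 (λ d → f (x ∷ d)) v))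

-- Both sides are polynomials in the operators `Tᵢ`, which commute although they truncate at 0:
-- truncated shifts of one entry compose by `sh-sh`. Hence the series are symmetric in their
-- variables.
U-comm : ∀ w m n f b → U w m (U w n f) b ≡ U w n (U w m f) b
U-comm w m n f []      = *ℤ-swap (κ m 0) (κ n 0) (f [])
U-comm w m n f (x ∷ v) = begin
  U w m (U w n f) (x ∷ v)
    ≡⟨ expand m n ⟩
  anti m (λ i r → anti n (λ j s → w i *ℤ (w j *ℤ sh (i + j) x (λ y → U w r (U w s (at y)) v))))
    ≡⟨ anti-anti m n _ ⟩
  anti n (λ j s → anti m (λ i r → w i *ℤ (w j *ℤ sh (i + j) x (λ y → U w r (U w s (at y)) v))))
    ≡⟨ anti-cong n (λ j s _ → anti-cong m λ i r _ → trans (*ℤ-swap (w i) (w j) _)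
         (cong (λ z → w j *ℤ (w i *ℤ z)) (trans (cong (λ k → sh k x λ y → U w r (U w s (at y)) v) (ℕₚ.+-comm i j))
           (sh-cong (j + i) x λ y → U-comm w r s (at y) v)))) ⟩
  anti n (λ j s → anti m (λ i r → w j *ℤ (w i *ℤ sh (j + i) x (λ y → U w s (U w r (at y)) v))))
    ≡⟨ expand n m ⟨
  U w n (U w m f) (x ∷ v) ∎
  where
  at : ℕ → List ℕ → ℤ
  at y d = f (y ∷ d)

  expand : ∀ m n → U w m (U w n f) (x ∷ v) ≡
    anti m (λ i r → anti n (λ j s → w i *ℤ (w j *ℤ sh (i + j) x (λ y → U w r (U w s (at y)) v))))
  expand m n = anti-cong m λ i r _ → begin
    w i *ℤ sh i x (λ x′ → U w r (λ d → U w n f (x′ ∷ d)) v)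
      ≡⟨ cong (w i *ℤ_) (sh-cong i x λ x′ → trans (through-anti (U-linear w r v) n _)
           (anti-cong n λ j s _ → trans (scale (U-linear w r v) (w j) _)
             (cong (w j *ℤ_) (through-sh (U-linear w r v) j x′ (λ y d → U w s (at y) d))))) ⟩
    w i *ℤ sh i x (λ x′ → anti n (λ j s → w j *ℤ sh j x′ (λ y → U w r (U w s (at y)) v)))
      ≡⟨ cong (w i *ℤ_) (through-anti (sh-linear i x) n _) ⟩
    w i *ℤ anti n (λ j s → sh i x (λ x′ → w j *ℤ sh j x′ (λ y → U w r (U w s (at y)) v)))
      ≡⟨ anti-* n (w i) _ ⟨
    anti n (λ j s → w i *ℤ sh i x (λ x′ → w j *ℤ sh j x′ (λ y → U w r (U w s (at y)) v)))
      ≡⟨ anti-cong n (λ j s _ → cong (w i *ℤ_) (trans (scale (sh-linear i x) (w j) _)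
           (cong (w j *ℤ_) (sh-sh i j x _)))) ⟩
    anti n (λ j s → w i *ℤ (w j *ℤ sh (i + j) x (λ y → U w r (U w s (at y)) v))) ∎

P-linear : ∀ n b → IsLinear (λ f → P n f b)
P-linear n []      = record { ext = λ _ → refl ; plus = λ _ _ → refl ; scale = λ c _ → sym (ℤₚ.*-zeroʳ c) }
P-linear n (x ∷ v) = record
  { ext   = λ e → cong₂ _+ℤ_ (sh-cong n x λ y → e (y ∷ v)) (ext (P-linear n v) λ d → e (x ∷ d))
  ; plus  = λ f g → trans (cong₂ _+ℤ_ (plus (sh-linear n x) _ _) (plus (P-linear n v) _ _))
                      (+ℤ-interchange (sh n x λ y → f (y ∷ v)) _ _ _)
  ; scale = λ c f → trans (cong₂ _+ℤ_ (scale (sh-linear n x) c _) (scale (P-linear n v) c _))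
                      (sym (ℤₚ.*-distribˡ-+ c _ _))
  }

-- Newton's identities for the lowering operators

-- The relation z W′(z) = π(z) W(z) up to degree N.
LogDerivative : ℕ → (ℕ → ℤ) → (ℕ → ℤ) → Set
LogDerivative N w π = ∀ n → n ≤ N → pos n *ℤ w n ≡ anti n (λ i j → π i *ℤ w j)

-- The generating series of the `U w n` is the product of the `W(z Tᵢ)`. By the Leibniz rule
-- `z d/dz` multiplies it by `∑ᵢ π(z Tᵢ)`, whose coefficient of `z^n` is `π n` times `P n`. In the
-- induction `first` differentiates the factor of the first entry and `second` the remaining ones.
newton : ∀ {N w π} → LogDerivative N w π → ∀ n → n ≤ N → ∀ f b →
  pos n *ℤ U w n f b ≡ anti n (λ i j → π i *ℤ P i (U w j f) b)
newton {N} {w} {π} ld n n≤N f []      = trans (lem n) (sym (trans (anti-cong n λ i j _ → ℤₚ.*-zeroʳ (π i)) (anti-0 n)))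
  where
  lem : ∀ n → pos n *ℤ (κ n 0 *ℤ f []) ≡ 0ℤ
  lem zero    = refl
  lem (suc n) = ℤₚ.*-zeroʳ (pos (suc n))
newton {N} {w} {π} ld n n≤N f (x ∷ v) = begin
  pos n *ℤ anti n (λ j r → w j *ℤ sh j x (Φ r))
    ≡⟨ anti-weight n _ ⟩
  anti n (λ j r → pos j *ℤ (w j *ℤ sh j x (Φ r))) +ℤ anti n (λ j r → pos r *ℤ (w j *ℤ sh j x (Φ r)))
    ≡⟨ cong₂ _+ℤ_ first second ⟩
  anti n (λ i m → π i *ℤ sh i x (λ y → U w m f (y ∷ v))) +ℤ anti n (λ i m → π i *ℤ P i (λ d → U w m f (x ∷ d)) v)
    ≡⟨ anti-+ n _ _ ⟨
  anti n (λ i m → π i *ℤ sh i x (λ y → U w m f (y ∷ v)) +ℤ π i *ℤ P i (λ d → U w m f (x ∷ d)) v)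
    ≡⟨ anti-cong n (λ i m _ → sym (ℤₚ.*-distribˡ-+ (π i) (sh i x λ y → U w m f (y ∷ v)) _)) ⟩
  anti n (λ i m → π i *ℤ P i (U w m f) (x ∷ v)) ∎
  where
  Φ : ℕ → ℕ → ℤ
  Φ r y = U w r (λ d → f (y ∷ d)) v

  first : anti n (λ j r → pos j *ℤ (w j *ℤ sh j x (Φ r))) ≡ anti n (λ i m → π i *ℤ sh i x (λ y → U w m f (y ∷ v)))
  first = begin
    anti n (λ j r → pos j *ℤ (w j *ℤ sh j x (Φ r)))
      ≡⟨ anti-cong n (λ j r e → begin
           pos j *ℤ (w j *ℤ sh j x (Φ r))
             ≡⟨ ℤₚ.*-assoc (pos j) (w j) _ ⟨
           pos j *ℤ w j *ℤ sh j x (Φ r)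
             ≡⟨ cong (_*ℤ sh j x (Φ r)) (ld j (ℕₚ.≤-trans (subst (j ≤_) e (ℕₚ.m≤m+n j r)) n≤N)) ⟩
           anti j (λ i l → π i *ℤ w l) *ℤ sh j x (Φ r)
             ≡⟨ ℤₚ.*-comm _ (sh j x (Φ r)) ⟩
           sh j x (Φ r) *ℤ anti j (λ i l → π i *ℤ w l)
             ≡⟨ anti-* j (sh j x (Φ r)) _ ⟨
           anti j (λ i l → sh j x (Φ r) *ℤ (π i *ℤ w l))
             ≡⟨ anti-cong j (λ { i l refl → rot (sh (i + l) x (Φ r)) (π i) (w l) }) ⟩
           anti j (λ i l → π i *ℤ (w l *ℤ sh (i + l) x (Φ r))) ∎) ⟩
    anti n (λ j r → anti j (λ i l → π i *ℤ (w l *ℤ sh (i + l) x (Φ r))))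
      ≡⟨ anti-assoc n (λ i l r → π i *ℤ (w l *ℤ sh (i + l) x (Φ r))) ⟩
    anti n (λ i m → anti m (λ l r → π i *ℤ (w l *ℤ sh (i + l) x (Φ r))))
      ≡⟨ anti-cong n (λ i m _ → trans (anti-* m (π i) _) (cong (π i *ℤ_) (sym (
           trans (through-anti (sh-linear i x) m _) (anti-cong m λ l r _ →
             trans (scale (sh-linear i x) (w l) _) (cong (w l *ℤ_) (sh-sh i l x (Φ r)))))))) ⟩
    anti n (λ i m → π i *ℤ sh i x (λ y → U w m f (y ∷ v))) ∎
    where
    rot : ∀ a b c → a *ℤ (b *ℤ c) ≡ b *ℤ (c *ℤ a)
    rot = solve-∀

  second : anti n (λ j r → pos r *ℤ (w j *ℤ sh j x (Φ r))) ≡ anti n (λ i m → π i *ℤ P i (λ d → U w m f (x ∷ d)) v)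
  second = begin
    anti n (λ j r → pos r *ℤ (w j *ℤ sh j x (Φ r)))
      ≡⟨ anti-cong n (λ j r e → begin
           pos r *ℤ (w j *ℤ sh j x (Φ r))
             ≡⟨ *ℤ-swap (pos r) (w j) _ ⟩
           w j *ℤ (pos r *ℤ sh j x (Φ r))
             ≡⟨ cong (w j *ℤ_) (scale (sh-linear j x) (pos r) (Φ r)) ⟨
           w j *ℤ sh j x (λ y → pos r *ℤ Φ r y)
             ≡⟨ cong (w j *ℤ_) (sh-cong j x λ y →
                  newton {π = π} ld r (ℕₚ.≤-trans (subst (r ≤_) e (ℕₚ.m≤n+m r j)) n≤N) (λ d → f (y ∷ d)) v) ⟩
           w j *ℤ sh j x (λ y → anti r (λ i s → π i *ℤ P i (U w s (λ d → f (y ∷ d))) v))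
             ≡⟨ cong (w j *ℤ_) (through-anti (sh-linear j x) r _) ⟩
           w j *ℤ anti r (λ i s → sh j x (λ y → π i *ℤ P i (U w s (λ d → f (y ∷ d))) v))
             ≡⟨ anti-* r (w j) _ ⟨
           anti r (λ i s → w j *ℤ sh j x (λ y → π i *ℤ P i (U w s (λ d → f (y ∷ d))) v))
             ≡⟨ anti-cong r (λ i s _ → trans (cong (w j *ℤ_) (scale (sh-linear j x) (π i) _)) (*ℤ-swap (w j) (π i) _)) ⟩
           anti r (λ i s → π i *ℤ (w j *ℤ sh j x (λ y → P i (U w s (λ d → f (y ∷ d))) v))) ∎) ⟩
    anti n (λ j r → anti r (λ i s → π i *ℤ (w j *ℤ sh j x (λ y → P i (U w s (λ d → f (y ∷ d))) v))))
      ≡⟨ anti-swap n _ ⟩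
    anti n (λ i m → anti m (λ j s → π i *ℤ (w j *ℤ sh j x (λ y → P i (U w s (λ d → f (y ∷ d))) v))))
      ≡⟨ anti-cong n (λ i m _ → trans (anti-* m (π i) _) (cong (π i *ℤ_) (sym (
           trans (through-anti (P-linear i v) m _) (anti-cong m λ j s _ →
             trans (scale (P-linear i v) (w j) _) (cong (w j *ℤ_)
               (through-sh (P-linear i v) j x (λ y d → U w s (λ d → f (y ∷ d)) d)))))))) ⟩
    anti n (λ i m → π i *ℤ P i (λ d → U w m f (x ∷ d)) v) ∎

-- The coefficient of x^γ in the series attached to the β-numbers b, one variable at
-- a time; e gives the constant terms.
E : (ℕ → ℤ) → (List ℕ → ℤ) → List ℕ → List ℕ → ℤ
E w e []      b = e b
E w e (c ∷ γ) b = U w c (E w e γ) b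

E-∷ʳ : ∀ w e γ c b → E w e (γ ++ [ c ]) b ≡ U w c (E w e γ) b
E-∷ʳ w e []      c b = refl
E-∷ʳ w e (d ∷ γ) c b = trans (U-cong w d b (E-∷ʳ w e γ c)) (U-comm w d c (E w e γ) b)

-- `schur` reads the exponents backwards and `modularSchur` forwards; symmetry in the variables
-- reconciles the two.
E-reverse : ∀ w e γ b → E w e (reverse γ) b ≡ E w e γ b
E-reverse w e []      b = refl
E-reverse w e (c ∷ γ) b = begin
  E w e (reverse (c ∷ γ)) b         ≡⟨ cong (λ δ → E w e δ b) (Listₚ.unfold-reverse c γ) ⟩
  E w e (reverse γ ++ [ c ]) b      ≡⟨ E-∷ʳ w e (reverse γ) c b ⟩
  U w c (E w e (reverse γ)) b       ≡⟨ U-cong w c b (E-reverse w e γ) ⟩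
  U w c (E w e γ) b                 ∎

-- Newton's identities express π n · P n through the operators U w j with j ≤ n,
-- whose values are among the coefficients E.
power-sums-determined : ∀ {N w w′ π π′ e b} →
  LogDerivative N w π → LogDerivative N w′ π′ → w 0 ≡ 1ℤ → w′ 0 ≡ 1ℤ →
  (∀ γ → E w e γ b ≡ E w′ e γ b) →
  ∀ n → n ≤ N → ∀ γ → π n *ℤ P n (E w e γ) b ≡ π′ n *ℤ P n (E w′ e γ) b
power-sums-determined {N} {w} {w′} {π} {π′} {e} {b} ld ld′ w0 w′0 same =
  <-rec (λ n → n ≤ N → ∀ γ → X n γ ≡ X′ n γ) step
  where
  X X′ : ℕ → List ℕ → ℤ
  X  n γ = π n *ℤ P n (E w e γ) b
  X′ n γ = π′ n *ℤ P n (E w′ e γ) b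

  newton-sums : ∀ n → n ≤ N → ∀ γ → anti n (λ i j → X i (j ∷ γ)) ≡ anti n (λ i j → X′ i (j ∷ γ))
  newton-sums n n≤N γ = begin
    anti n (λ i j → X i (j ∷ γ))      ≡⟨ newton {π = π} ld n n≤N (E w e γ) b ⟨
    pos n *ℤ E w e (n ∷ γ) b          ≡⟨ cong (pos n *ℤ_) (same (n ∷ γ)) ⟩
    pos n *ℤ E w′ e (n ∷ γ) b         ≡⟨ newton {π = π′} ld′ n n≤N (E w′ e γ) b ⟩
    anti n (λ i j → X′ i (j ∷ γ))     ∎

  last : ∀ n γ → (∀ i → i < n → ∀ δ → X i δ ≡ X′ i δ) →
    anti n (λ i j → X i (j ∷ γ)) ≡ anti n (λ i j → X′ i (j ∷ γ)) → X n (0 ∷ γ) ≡ X′ n (0 ∷ γ)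
  last zero    γ ih eq = eq
  last (suc n) γ ih eq = +ℤ-cancelˡ (anti n λ i j → X i (suc j ∷ γ)) _ _ (begin
    anti n (λ i j → X i (suc j ∷ γ)) +ℤ X (suc n) (0 ∷ γ)       ≡⟨ anti-last n (λ i j → X i (j ∷ γ)) ⟨
    anti (suc n) (λ i j → X i (j ∷ γ))                          ≡⟨ eq ⟩
    anti (suc n) (λ i j → X′ i (j ∷ γ))                         ≡⟨ anti-last n (λ i j → X′ i (j ∷ γ)) ⟩
    anti n (λ i j → X′ i (suc j ∷ γ)) +ℤ X′ (suc n) (0 ∷ γ)
      ≡⟨ cong (_+ℤ X′ (suc n) (0 ∷ γ)) (anti-cong n λ i j ij →
           sym (ih i (s≤s (subst (i ≤_) ij (ℕₚ.m≤m+n i j))) (suc j ∷ γ))) ⟩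
    anti n (λ i j → X i (suc j ∷ γ)) +ℤ X′ (suc n) (0 ∷ γ)      ∎)

  step : ∀ n → (∀ {i} → i < n → i ≤ N → ∀ γ → X i γ ≡ X′ i γ) → n ≤ N → ∀ γ → X n γ ≡ X′ n γ
  -- In degree `n` only the term `i = n` is not yet known to agree. The others occur at longer
  -- weights `suc j ∷ γ`, so the induction has to treat all `γ` at once.
  step n ih n≤N γ = begin
    X n γ         ≡⟨ cong (π n *ℤ_) (ext (P-linear n b) (U-0 w w0 (E w e γ))) ⟨
    X n (0 ∷ γ)   ≡⟨ last n γ (λ i i<n → ih i<n (ℕₚ.≤-trans (ℕₚ.<⇒≤ i<n) n≤N)) (newton-sums n n≤N γ) ⟩
    X′ n (0 ∷ γ)  ≡⟨ cong (π′ n *ℤ_) (ext (P-linear n b) (U-0 w′ w′0 (E w′ e γ))) ⟩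
    X′ n γ        ∎

-- Logarithmic derivatives of the two weight series

𝟙 : ℕ → ℤ
𝟙 _ = 1ℤ

below : ℕ → ℕ → ℤ
below k j = if does (j <? k) then 1ℤ else 0ℤ

below-< : ∀ {k j} → j < k → below k j ≡ 1ℤ
below-< {k} {j} j<k = cong (if_then 1ℤ else 0ℤ) (dec-true (j <? k) j<k)

below-≮ : ∀ {k j} → ¬ j < k → below k j ≡ 0ℤ
below-≮ {k} {j} j≮k = cong (if_then 1ℤ else 0ℤ) (dec-false (j <? k) j≮k)

-- The coefficients of `z W′/W = z/(1 - z)` for `W = 1/(1 - z)`.
positive : ℕ → ℤ
positive zero    = 0ℤ
positive (suc _) = 1ℤ

anti-positive : ∀ n → anti n (λ i _ → positive i) ≡ pos n
anti-positive zero    = refl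
anti-positive (suc n) = trans (ℤₚ.+-identityˡ _) (anti-const n)

logDerivative-𝟙 : ∀ N → LogDerivative N 𝟙 positive
logDerivative-𝟙 N n _ = begin
  pos n *ℤ 1ℤ                            ≡⟨ ℤₚ.*-identityʳ (pos n) ⟩
  pos n                                  ≡⟨ anti-positive n ⟨
  anti n (λ i _ → positive i)            ≡⟨ anti-cong n (λ i j _ → sym (ℤₚ.*-identityʳ (positive i))) ⟩
  anti n (λ i _ → positive i *ℤ 1ℤ)      ∎

-- 1 + z + ⋯ + z^(k-1) = (1 - z^k) / (1 - z).
petrieπ : ℕ → ℕ → ℤ
petrieπ k i = positive i -ℤ (if does (i ≟ k) then pos k else 0ℤ)

petrieπ-k : ∀ k → 0 < k → petrieπ k k ≡ 1ℤ -ℤ pos k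
petrieπ-k k@(suc _) _ = cong (λ b → 1ℤ -ℤ (if b then pos k else 0ℤ)) (dec-true (k ≟ k) refl)

petrieπ-≢ : ∀ k i → i ≢ k → petrieπ k i ≡ positive i
petrieπ-≢ k i i≢k = trans (cong (λ b → positive i -ℤ (if b then pos k else 0ℤ)) (dec-false (i ≟ k) i≢k))
  (ℤₚ.+-identityʳ (positive i))

-- The full logarithmic derivative is `z/(1 - z) - k z^k/(1 - z^k)`. Up to degree `k` only the first
-- term of the second series counts, and this is all that `petrieπ` contains. Below degree `k`
-- nothing differs from `1/(1 - z)`; in degree `k` the `k - 1` ones cancel against `1 - k`.
logDerivative-below : ∀ k → 0 < k → LogDerivative k (below k) (petrieπ k)
logDerivative-below k@(suc k′) 0<k n n≤k with n ≟ k
... | no n≢k = begin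
  pos n *ℤ below k n                     ≡⟨ cong (pos n *ℤ_) (below-< n<k) ⟩
  pos n *ℤ 1ℤ                            ≡⟨ logDerivative-𝟙 n n ℕₚ.≤-refl ⟩
  anti n (λ i _ → positive i *ℤ 1ℤ)      ≡⟨ anti-cong n (λ i j e → cong₂ _*ℤ_
                                              (petrieπ-≢ k i (λ i≡k → ℕₚ.<⇒≢ (ℕₚ.≤-<-trans (subst (i ≤_) e (ℕₚ.m≤m+n i j)) n<k) i≡k))
                                              (below-< (ℕₚ.≤-<-trans (subst (j ≤_) e (ℕₚ.m≤n+m j i)) n<k))) ⟨
  anti n (λ i j → petrieπ k i *ℤ below k j) ∎
  where
  n<k : n < k
  n<k = ℕₚ.≤∧≢⇒< n≤k n≢k
... | yes refl = begin
  pos k *ℤ below k k                     ≡⟨ cong (pos k *ℤ_) (below-≮ (ℕₚ.n≮n k)) ⟩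
  pos k *ℤ 0ℤ                            ≡⟨ ℤₚ.*-zeroʳ (pos k) ⟩
  0ℤ                                     ≡⟨ ℤₚ.+-inverseʳ (pos k) ⟨
  pos k -ℤ pos k                         ≡⟨ cong (_-ℤ pos k) (anti-positive k) ⟨
  anti k (λ i _ → positive i) -ℤ pos k
    ≡⟨ cong (_-ℤ pos k) (anti-last k′ (λ i _ → positive i)) ⟩
  anti k′ (λ i _ → positive i) +ℤ 1ℤ -ℤ pos k
    ≡⟨ ℤₚ.+-assoc (anti k′ λ i _ → positive i) 1ℤ (-ℤ pos k) ⟩
  anti k′ (λ i _ → positive i) +ℤ (1ℤ -ℤ pos k)
    ≡⟨ cong₂ _+ℤ_ (anti-cong k′ small) top ⟩
  anti k′ (λ i j → petrieπ k i *ℤ below k (suc j)) +ℤ petrieπ k k *ℤ below k 0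
    ≡⟨ anti-last k′ (λ i j → petrieπ k i *ℤ below k j) ⟨
  anti k (λ i j → petrieπ k i *ℤ below k j) ∎
  where
  top : 1ℤ -ℤ pos k ≡ petrieπ k k *ℤ below k 0
  top = sym (trans (cong₂ _*ℤ_ (petrieπ-k k 0<k) (below-< {k} {0} 0<k)) (ℤₚ.*-identityʳ _))

  small : ∀ i j → i + j ≡ k′ → positive i ≡ petrieπ k i *ℤ below k (suc j)
  small zero    j e = sym (cong (_*ℤ below k (suc j)) (petrieπ-≢ k 0 (λ ())))
  small (suc i) j e = sym (trans (cong₂ _*ℤ_
    (petrieπ-≢ k (suc i) (ℕₚ.<⇒≢ (s≤s (subst (suc i ≤_) e (ℕₚ.m≤m+n (suc i) j)))))
    (below-< (s≤s (subst (suc j ≤_) e (s≤s (ℕₚ.m≤n+m j i)))))) refl)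

petrie-power-sum : ∀ k → 0 < k → ∀ e b → (∀ γ → E (below k) e γ b ≡ E 𝟙 e γ b) →
  ∀ γ → (1ℤ -ℤ pos k) *ℤ P k (E (below k) e γ) b ≡ P k (E 𝟙 e γ) b
petrie-power-sum k@(suc _) 0<k e b same γ = begin
  (1ℤ -ℤ pos k) *ℤ P k (E (below k) e γ) b   ≡⟨ cong (_*ℤ P k (E (below k) e γ) b) (petrieπ-k k 0<k) ⟨
  petrieπ k k *ℤ P k (E (below k) e γ) b
    ≡⟨ power-sums-determined {π = petrieπ k} {positive} (logDerivative-below k 0<k) (logDerivative-𝟙 k)
         (below-< {k} {0} 0<k) refl same k ℕₚ.≤-refl γ ⟩
  1ℤ *ℤ P k (E 𝟙 e γ) b                      ≡⟨ ℤₚ.*-identityˡ _ ⟩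
  P k (E 𝟙 e γ) b                            ∎

-- Alternating functions of vectors

Alternating : (List ℕ → ℤ) → Set
Alternating f = ∀ u x y v → f (u ++ x ∷ y ∷ v) ≡ -ℤ f (u ++ y ∷ x ∷ v)

alternating-∷ : ∀ {f} x → Alternating f → Alternating (λ d → f (x ∷ d))
alternating-∷ x af u = af (x ∷ u)

≡-⇒≡0 : ∀ i → i ≡ -ℤ i → i ≡ 0ℤ
≡-⇒≡0 (pos zero)         _ = refl
≡-⇒≡0 (pos (suc _))      ()
≡-⇒≡0 (-[1+ _ ]) ()

alternating-repeat : ∀ {f} → Alternating f → ∀ u x v → f (u ++ x ∷ x ∷ v) ≡ 0ℤ
alternating-repeat af u x v = ≡-⇒≡0 _ (af u x x v)

-- The same weights act on every entry, so the operator commutes with swapping two entries;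
-- `anti-swap` exchanges the degrees spent on them.
U-alternating : ∀ w n {f} → Alternating f → Alternating (U w n f)
U-alternating w n {f} af (z ∷ u) x y v = begin
  anti n (λ j r → w j *ℤ sh j z (λ z′ → U w r (at z′) (u ++ x ∷ y ∷ v)))
    ≡⟨ anti-cong n (λ j r _ → cong (w j *ℤ_) (sh-cong j z λ z′ →
         U-alternating w r (alternating-∷ {f} z′ af) u x y v)) ⟩
  anti n (λ j r → w j *ℤ sh j z (λ z′ → -ℤ U w r (at z′) (u ++ y ∷ x ∷ v)))
    ≡⟨ anti-cong n (λ j r _ → trans (cong (w j *ℤ_) (neg (sh-linear j z) _))
         (trans (ℤₚ.*-comm (w j) _) (sym (trans (ℤₚ.-1*i≡-i _) (trans (ℤₚ.neg-distribʳ-* (w j) _) (ℤₚ.*-comm (w j) _)))))) ⟩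
  anti n (λ j r → -ℤ 1ℤ *ℤ (w j *ℤ sh j z (λ z′ → U w r (at z′) (u ++ y ∷ x ∷ v))))
    ≡⟨ trans (anti-* n (-ℤ 1ℤ) _) (ℤₚ.-1*i≡-i _) ⟩
  -ℤ U w n f (z ∷ u ++ y ∷ x ∷ v) ∎
  where
  at : ℕ → List ℕ → ℤ
  at z′ d = f (z′ ∷ d)
U-alternating w n {f} af [] x y v = begin
  U w n f (x ∷ y ∷ v)
    ≡⟨ expand f x y ⟩
  anti n (λ i r → anti r (λ j s → w i *ℤ (w j *ℤ sh i x (λ x′ → sh j y (λ y′ → U w s (at f x′ y′) v)))))
    ≡⟨ anti-swap n _ ⟩
  anti n (λ j r → anti r (λ i s → w i *ℤ (w j *ℤ sh i x (λ x′ → sh j y (λ y′ → U w s (at f x′ y′) v)))))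
    ≡⟨ anti-cong n (λ j r _ → anti-cong r λ i s _ → trans (*ℤ-swap (w i) (w j) _)
         (cong (λ q → w j *ℤ (w i *ℤ q)) (trans (through-sh (sh-linear i x) j y (λ y′ x′ → U w s (at f x′ y′) v))
           (sh-cong j y λ y′ → sh-cong i x λ x′ → U-cong w s v λ d → af [] x′ y′ d)))) ⟩
  anti n (λ j r → anti r (λ i s → w j *ℤ (w i *ℤ sh j y (λ y′ → sh i x (λ x′ → U w s (at f⁻ y′ x′) v)))))
    ≡⟨ expand f⁻ y x ⟨
  U w n f⁻ (y ∷ x ∷ v)
    ≡⟨ neg (U-linear w n (y ∷ x ∷ v)) f ⟩
  -ℤ U w n f (y ∷ x ∷ v) ∎
  where
  f⁻ : List ℕ → ℤ
  f⁻ d = -ℤ f d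

  at : (List ℕ → ℤ) → ℕ → ℕ → List ℕ → ℤ
  at g x′ y′ d = g (x′ ∷ y′ ∷ d)

  expand : ∀ g x y → U w n g (x ∷ y ∷ v) ≡
    anti n (λ i r → anti r (λ j s → w i *ℤ (w j *ℤ sh i x (λ x′ → sh j y (λ y′ → U w s (at g x′ y′) v)))))
  expand g x y = anti-cong n λ i r _ → trans
    (cong (w i *ℤ_) (trans (through-anti (sh-linear i x) r _)
      (anti-cong r λ j s _ → scale (sh-linear i x) (w j) _)))
    (sym (anti-* r (w i) _))

E-alternating : ∀ w γ {e} → Alternating e → Alternating (E w e γ)
E-alternating w []      ae = ae
E-alternating w (c ∷ γ) ae = U-alternating w c (E-alternating w γ ae)

-- Signed expansions, constant terms and β-numbers

-- ∑ⱼ (-1)^j F (qⱼ) (q without qⱼ)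
alt : (ℕ → List ℕ → ℤ) → List ℕ → ℤ
alt F []      = 0ℤ
alt F (y ∷ q) = F y q -ℤ alt (λ z r → F z (y ∷ r)) q

alt-cong : ∀ q {F G : ℕ → List ℕ → ℤ} → (∀ y r → F y r ≡ G y r) → alt F q ≡ alt G q
alt-cong []      e = refl
alt-cong (y ∷ q) e = cong₂ _-ℤ_ (e y q) (alt-cong q λ z r → e z (y ∷ r))

alt-linear : ∀ q → IsLinear (λ (F : ℕ × List ℕ → ℤ) → alt (λ y r → F (y , r)) q)
alt-linear q = record { ext = λ e → alt-cong q λ y r → e (y , r) ; plus = λ F G → alt-+ q _ _ ; scale = λ c F → alt-* q c _ }
  where
  alt-+ : ∀ q (F G : ℕ → List ℕ → ℤ) → alt (λ y r → F y r +ℤ G y r) q ≡ alt F q +ℤ alt G q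
  alt-+ []      F G = refl
  alt-+ (y ∷ q) F G = trans (cong (_-ℤ_ (F y q +ℤ G y q)) (alt-+ q _ _)) (lem (F y q) _ _ _)
    where
    lem : ∀ a b c d → (a +ℤ b) -ℤ (c +ℤ d) ≡ (a -ℤ c) +ℤ (b -ℤ d)
    lem = solve-∀
  alt-* : ∀ q c (F : ℕ → List ℕ → ℤ) → alt (λ y r → c *ℤ F y r) q ≡ c *ℤ alt F q
  alt-* []      c F = sym (ℤₚ.*-zeroʳ c)
  alt-* (y ∷ q) c F = trans (cong (_-ℤ_ (c *ℤ F y q)) (alt-* q c _)) (lem c (F y q) _)
    where
    lem : ∀ c a b → c *ℤ a -ℤ c *ℤ b ≡ c *ℤ (a -ℤ b)
    lem = solve-∀

alt-minus : ∀ q (F G : ℕ → List ℕ → ℤ) → alt (λ y r → F y r -ℤ G y r) q ≡ alt F q -ℤ alt G q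
alt-minus q F G = trans (plus (alt-linear q) (λ { (y , r) → F y r }) (λ { (y , r) → -ℤ G y r }))
  (cong (alt F q +ℤ_) (neg (alt-linear q) (λ { (y , r) → G y r })))

-- Choosing two columns in either order leaves the same remaining columns, with opposite signs. This
-- is the source of the antisymmetry of determinants in their rows.
alt-alt : ∀ q (K : ℕ → ℕ → List ℕ → ℤ) →
  alt (λ y r → alt (K y) r) q ≡ -ℤ alt (λ y r → alt (λ z → K z y) r) q
alt-alt []      K = refl
alt-alt (y ∷ q) K = begin
  alt (K y) q -ℤ alt (λ z r → K z y r -ℤ alt (λ t s → K z t (y ∷ s)) r) q
    ≡⟨ cong (_-ℤ_ (alt (K y) q)) (trans (alt-minus q (λ z → K z y) _)
         (cong (_-ℤ_ (alt (λ z → K z y) q)) (alt-alt q (λ z t s → K z t (y ∷ s))))) ⟩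
  alt (K y) q -ℤ (alt (λ z → K z y) q -ℤ -ℤ K′)
    ≡⟨ lem (alt (K y) q) (alt (λ z → K z y) q) K′ ⟩
  -ℤ (alt (λ z → K z y) q -ℤ (alt (K y) q -ℤ K′))
    ≡⟨ cong (λ c → -ℤ (alt (λ z → K z y) q -ℤ c)) (alt-minus q (K y) _) ⟨
  -ℤ (alt (λ z → K z y) q -ℤ alt (λ z r → K y z r -ℤ alt (λ t s → K t z (y ∷ s)) r) q) ∎
  where
  K′ : ℤ
  K′ = alt (λ z r → alt (λ t s → K t z (y ∷ s)) r) q
  lem : ∀ a b c → a -ℤ (b -ℤ -ℤ c) ≡ -ℤ (b -ℤ (a -ℤ c))
  lem = solve-∀

alt-zero : ∀ q {F : ℕ → List ℕ → ℤ} → All (λ y → ∀ r → F y r ≡ 0ℤ) q → alt F q ≡ 0ℤ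
alt-zero []      []       = refl
alt-zero (y ∷ q) (e ∷ es) = cong₂ _-ℤ_ (e q) (alt-zero q (All.map (λ e r → e (y ∷ r)) es))

κ-≢ : ∀ {x y} → x ≢ y → κ x y ≡ 0ℤ
κ-≢ {x} {y} ne = cong (if_then 1ℤ else 0ℤ) (dec-false (x ≟ y) ne)

κ-refl : ∀ x → κ x x ≡ 1ℤ
κ-refl x = cong (if_then 1ℤ else 0ℤ) (dec-true (x ≟ x) refl)

-- The determinant of the matrix with rows b, columns q and entries κ.
κ-det : List ℕ → List ℕ → ℤ
κ-det q []      = 1ℤ
κ-det q (x ∷ v) = alt (λ y r → κ x y *ℤ κ-det r v) q

κ-det-alternating : ∀ q → Alternating (κ-det q)
κ-det-alternating q (z ∷ u) x y v = trans
  (alt-cong q λ t r → trans (cong (κ z t *ℤ_) (κ-det-alternating r u x y v)) (sym (ℤₚ.neg-distribʳ-* (κ z t) _)))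
  (neg (alt-linear q) (λ { (t , r) → κ z t *ℤ κ-det r (u ++ y ∷ x ∷ v) }))
κ-det-alternating q [] x y v = begin
  alt (λ s r → κ x s *ℤ κ-det r (y ∷ v)) q
    ≡⟨ expand x y ⟩
  alt (λ s r → alt (λ t r′ → κ x s *ℤ (κ y t *ℤ κ-det r′ v)) r) q
    ≡⟨ alt-alt q _ ⟩
  -ℤ alt (λ s r → alt (λ t r′ → κ x t *ℤ (κ y s *ℤ κ-det r′ v)) r) q
    ≡⟨ cong -ℤ_ (alt-cong q λ s r → alt-cong r λ t r′ → *ℤ-swap (κ x t) (κ y s) _) ⟩
  -ℤ alt (λ s r → alt (λ t r′ → κ y s *ℤ (κ x t *ℤ κ-det r′ v)) r) q
    ≡⟨ cong -ℤ_ (expand y x) ⟨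
  -ℤ alt (λ s r → κ y s *ℤ κ-det r (x ∷ v)) q ∎
  where
  expand : ∀ x y → alt (λ s r → κ x s *ℤ κ-det r (y ∷ v)) q ≡
    alt (λ s r → alt (λ t r′ → κ x s *ℤ (κ y t *ℤ κ-det r′ v)) r) q
  expand x y = alt-cong q λ s r → sym (scale (alt-linear r) (κ x s) (λ { (t , r′) → κ y t *ℤ κ-det r′ v }))

-- The β-numbers of ν; they are its first-column hook lengths if ν has no zero parts.
β : List ℕ → List ℕ
β []      = []
β (x ∷ ν) = x + length ν ∷ β ν

downFrom-< : ∀ n → All (_< n) (downFrom n)
downFrom-< zero    = []
downFrom-< (suc n) = ℕₚ.n<1+n n ∷ All.map ℕₚ.m<n⇒m<1+n (downFrom-< n)

-- The constant term of a Schur function. All columns after the first are less than `ℓ`, so the row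
-- `x + ℓ` can meet only the first column `ℓ`, and it does so only for `x = 0`.
κ-det-β : ∀ ν → κ-det (downFrom (length ν)) (β ν) ≡ (if does (sum ν ≟ 0) then 1ℤ else 0ℤ)
κ-det-β []      = refl
κ-det-β (x ∷ ν) = begin
  κ (x + ℓ) ℓ *ℤ κ-det (downFrom ℓ) (β ν) -ℤ alt (λ z r → κ (x + ℓ) z *ℤ κ-det (ℓ ∷ r) (β ν)) (downFrom ℓ)
    ≡⟨ cong (λ c → κ (x + ℓ) ℓ *ℤ κ-det (downFrom ℓ) (β ν) -ℤ c) (alt-zero (downFrom ℓ)
         (All.map (λ z<ℓ r → cong (_*ℤ κ-det (ℓ ∷ r) (β ν))
           (κ-≢ λ e → ℕₚ.<⇒≱ z<ℓ (subst (ℓ ≤_) e (ℕₚ.m≤n+m ℓ x)))) (downFrom-< ℓ))) ⟩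
  κ (x + ℓ) ℓ *ℤ κ-det (downFrom ℓ) (β ν) -ℤ 0ℤ
    ≡⟨ ℤₚ.+-identityʳ _ ⟩
  κ (x + ℓ) ℓ *ℤ κ-det (downFrom ℓ) (β ν)
    ≡⟨ last x ⟩
  (if does (x + sum ν ≟ 0) then 1ℤ else 0ℤ) ∎
  where
  ℓ : ℕ
  ℓ = length ν
  last : ∀ x → κ (x + ℓ) ℓ *ℤ κ-det (downFrom ℓ) (β ν) ≡ (if does (x + sum ν ≟ 0) then 1ℤ else 0ℤ)
  last zero    = trans (cong (_*ℤ κ-det (downFrom ℓ) (β ν)) (κ-refl ℓ)) (trans (ℤₚ.*-identityˡ _) (κ-det-β ν))
  last (suc x) = cong (_*ℤ κ-det (downFrom ℓ) (β ν)) (κ-≢ λ e → ℕₚ.<⇒≢ (s≤s (ℕₚ.m≤n+m ℓ x)) (sym e))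

-- Zero parts are allowed because `horizontalStrips` preserves the length and so produces trailing
-- zeros.
Decreasing : List ℕ → Set
Decreasing []      = ⊤
Decreasing (x ∷ ν) = part ν 0 ≤ x × Decreasing ν

linked⇒decreasing : ∀ {ν} → Linked _≥_ ν → Decreasing ν
linked⇒decreasing []      = tt
linked⇒decreasing [-]     = z≤n , tt
linked⇒decreasing (p ∷ l) = p , linked⇒decreasing l

-- Horizontal strips, Pieri's rule and the Jacobi-Trudi identity

lsum : (A → ℤ) → List A → ℤ
lsum φ []      = 0ℤ
lsum φ (x ∷ l) = φ x +ℤ lsum φ l

lsum-cong : ∀ (l : List A) {φ ψ : A → ℤ} → (∀ x → x ∈ l → φ x ≡ ψ x) → lsum φ l ≡ lsum ψ l
lsum-cong []      e = refl
lsum-cong (x ∷ l) e = cong₂ _+ℤ_ (e x (here refl)) (lsum-cong l λ y y∈ → e y (there y∈))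

lsum-zero : ∀ (l : List A) {φ : A → ℤ} → (∀ x → x ∈ l → φ x ≡ 0ℤ) → lsum φ l ≡ 0ℤ
lsum-zero []      e = refl
lsum-zero (x ∷ l) e = cong₂ _+ℤ_ (e x (here refl)) (lsum-zero l λ y y∈ → e y (there y∈))

lsum-++ : ∀ (φ : A → ℤ) l m → lsum φ (l ++ m) ≡ lsum φ l +ℤ lsum φ m
lsum-++ φ []      m = sym (ℤₚ.+-identityˡ _)
lsum-++ φ (x ∷ l) m = trans (cong (φ x +ℤ_) (lsum-++ φ l m)) (sym (ℤₚ.+-assoc (φ x) _ _))

lsum-map : ∀ (φ : B → ℤ) (h : A → B) l → lsum φ (map h l) ≡ lsum (λ x → φ (h x)) l
lsum-map φ h []      = refl
lsum-map φ h (x ∷ l) = cong (φ (h x) +ℤ_) (lsum-map φ h l)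

lsum-product : ∀ (φ : C → ℤ) (h : A → B → C) xs ys →
  lsum φ (cartesianProductWith h xs ys) ≡ lsum (λ x → lsum (λ y → φ (h x y)) ys) xs
lsum-product φ h []       ys = refl
lsum-product φ h (x ∷ xs) ys = trans (lsum-++ φ (map (h x) ys) _)
  (cong₂ _+ℤ_ (lsum-map φ (h x) ys) (lsum-product φ h xs ys))

when : ℕ → ℕ → ℤ → ℤ
when m n z = if does (m ≟ n) then z else 0ℤ

when-≢ : ∀ {m n} z → m ≢ n → when m n z ≡ 0ℤ
when-≢ {m} {n} z ne = cong (if_then z else 0ℤ) (dec-false (m ≟ n) ne)

when-≡ : ∀ {m n} z → m ≡ n → when m n z ≡ z
when-≡ {m} {n} z e = cong (if_then z else 0ℤ) (dec-true (m ≟ n) e)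

when-⇔ : ∀ {m n m′ n′} z → (m ≡ n → m′ ≡ n′) → (m′ ≡ n′ → m ≡ n) → when m n z ≡ when m′ n′ z
when-⇔ {m} {n} {m′} {n′} z to from with m ≟ n
... | yes e = trans (when-≡ z e) (sym (when-≡ z (to e)))
... | no ne = trans (when-≢ z ne) (sym (when-≢ z (λ e → ne (from e))))

lsum-filter : ∀ (g : A → ℕ) (s : A → ℕ) n l →
  pos (sum (map g (filter (λ x → s x ≟ n) l))) ≡ lsum (λ x → when (s x) n (pos (g x))) l
lsum-filter g s n []      = refl
lsum-filter g s n (x ∷ l) with s x ≟ n
... | yes e = trans (cong (λ m → pos (sum (map g m))) (Listₚ.filter-accept (λ x → s x ≟ n) {xs = l} e))
                (trans (ℤₚ.pos-+ (g x) _) (cong₂ _+ℤ_ (sym (when-≡ _ e)) (lsum-filter g s n l)))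
... | no ne = trans (cong (λ m → pos (sum (map g m))) (Listₚ.filter-reject (λ x → s x ≟ n) {xs = l} ne))
                (trans (lsum-filter g s n l) (sym (trans (cong (_+ℤ _) (when-≢ _ ne)) (ℤₚ.+-identityˡ _))))

strips-∈ : ∀ ν {ρ} → ρ ∈ horizontalStrips ν →
  length ρ ≡ length ν × sum ρ ≤ sum ν × part ρ 0 ≤ part ν 0 × Decreasing ρ
strips-∈ []      (here refl) = refl , z≤n , z≤n , tt
strips-∈ (x ∷ ν) ρ∈ with ∈ₚ.∈-cartesianProductWith⁻ _∷_ (filter (part ν 0 ≤?_) (upTo (suc x))) (horizontalStrips ν) ρ∈
... | y , ρ , y∈ , ρ∈′ , refl with ∈ₚ.∈-filter⁻ (part ν 0 ≤?_) {xs = upTo (suc x)} y∈ | strips-∈ ν ρ∈′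
... | y∈upTo , ν₀≤y | l , s , h , d = cong suc l , ℕₚ.+-mono-≤ y≤x s , y≤x , (ℕₚ.≤-trans h ν₀≤y , d)
  where
  y≤x : y ≤ x
  y≤x = ℕₚ.≤-pred (∈ₚ.∈-upTo⁻ y∈upTo)

strip : (List ℕ → ℤ) → List ℕ → ℕ → ℤ
strip g ν a = lsum (λ ρ → when (a + sum ρ) (sum ν) (g ρ)) (horizontalStrips ν)

-- The convolution sum restricted to `i ≤ t`: a horizontal strip takes at most `t = ν₁ - ν₂` cells
-- from the first row.
anti≤ : ℕ → ℕ → (ℕ → ℕ → ℤ) → ℤ
anti≤ zero    a       F = F 0 a
anti≤ (suc t) zero    F = F 0 0
anti≤ (suc t) (suc a) F = F 0 (suc a) +ℤ anti≤ t a (λ i j → F (suc i) j)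

anti≤-cong : ∀ t a {F G : ℕ → ℕ → ℤ} → (∀ i j → i ≤ t → i + j ≡ a → F i j ≡ G i j) → anti≤ t a F ≡ anti≤ t a G
anti≤-cong zero    a       e = e 0 a z≤n refl
anti≤-cong (suc t) zero    e = e 0 0 z≤n refl
anti≤-cong (suc t) (suc a) e = cong₂ _+ℤ_ (e 0 (suc a) z≤n refl)
  (anti≤-cong t a λ i j i≤t e′ → e (suc i) j (s≤s i≤t) (cong suc e′))

interval : ℕ → ℕ → (ℕ → ℤ) → ℤ
interval zero    z φ = φ z
interval (suc t) z φ = φ (suc t + z) +ℤ interval t z φ

interval-zero : ∀ t z {φ : ℕ → ℤ} → (∀ y → y ≤ t + z → φ y ≡ 0ℤ) → interval t z φ ≡ 0ℤ
interval-zero zero    z e = e z ℕₚ.≤-refl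
interval-zero (suc t) z e = cong₂ _+ℤ_ (e _ ℕₚ.≤-refl) (interval-zero t z λ y y≤ → e y (ℕₚ.m≤n⇒m≤1+n y≤))

interval-filter : ∀ t z φ → lsum φ (filter (z ≤?_) (upTo (suc (t + z)))) ≡ interval t z φ
interval-filter t z φ = trans (cong (λ l → lsum φ (filter (z ≤?_) l)) (sym (Listₚ.upTo-∷ʳ (t + z))))
  (trans (cong (lsum φ) (Listₚ.filter-++ (z ≤?_) (upTo (t + z)) _))
  (trans (lsum-++ φ (filter (z ≤?_) (upTo (t + z))) _)
  (trans (ℤₚ.+-comm (lsum φ (filter (z ≤?_) (upTo (t + z)))) _) (trans (cong₂ _+ℤ_
    (trans (cong (lsum φ) (Listₚ.filter-accept (z ≤?_) {xs = []} (ℕₚ.m≤n+m z t))) (ℤₚ.+-identityʳ (φ (t + z)))) refl) (rest t)))))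
  where
  rest : ∀ t → φ (t + z) +ℤ lsum φ (filter (z ≤?_) (upTo (t + z))) ≡ interval t z φ
  rest zero    = trans (cong (λ l → φ z +ℤ lsum φ l) (Listₚ.filter-none (z ≤?_) {xs = upTo z}
    (All.tabulate λ y∈ z≤y → ℕₚ.<⇒≱ (∈ₚ.∈-upTo⁻ y∈) z≤y))) (ℤₚ.+-identityʳ _)
  rest (suc t) = cong (φ (suc t + z) +ℤ_) (interval-filter t z φ)

strip-∷ : ∀ g t ν a → strip g (t + part ν 0 ∷ ν) a ≡
  anti≤ t a (λ j r → strip (λ ρ → g (t + part ν 0 ∸ j ∷ ρ)) ν r)
strip-∷ g t ν a = trans (lsum-product _ _∷_ (filter (z ≤?_) (upTo (suc (t + z)))) (horizontalStrips ν))
  (trans (interval-filter t z _) (go t a))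
  where
  z : ℕ
  z = part ν 0
  go : ∀ t a → interval t z (λ y → lsum (λ ρ → when (a + (y + sum ρ)) (t + z + sum ν) (g (y ∷ ρ))) (horizontalStrips ν))
    ≡ anti≤ t a (λ j r → strip (λ ρ → g (t + z ∸ j ∷ ρ)) ν r)
  top : ∀ a y → lsum (λ ρ → when (a + (y + sum ρ)) (y + sum ν) (g (y ∷ ρ))) (horizontalStrips ν)
    ≡ strip (λ ρ → g (y ∷ ρ)) ν a
  top a y = lsum-cong (horizontalStrips ν) λ ρ _ → when-⇔ (g (y ∷ ρ))
    (λ e → ℕₚ.+-cancelˡ-≡ y _ _ (trans (swap y a (sum ρ)) e)) (λ e → trans (sym (swap y a (sum ρ))) (cong (y +_) e))
    where
    swap : ∀ y a s → y + (a + s) ≡ a + (y + s)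
    swap y a s = trans (sym (ℕₚ.+-assoc y a s)) (trans (cong (_+ s) (ℕₚ.+-comm y a)) (ℕₚ.+-assoc a y s))
  go zero    a       = top a z
  go (suc t) zero    = trans (cong₂ _+ℤ_ (top 0 (suc t + z)) (interval-zero t z λ y y≤ →
    lsum-zero (horizontalStrips ν) λ ρ ρ∈ → when-≢ (g (y ∷ ρ))
      (ℕₚ.<⇒≢ (s≤s (ℕₚ.+-mono-≤ y≤ (proj₁ (proj₂ (strips-∈ ν ρ∈)))))))) (ℤₚ.+-identityʳ _)
  go (suc t) (suc a) = cong₂ _+ℤ_ (top (suc a) (suc t + z)) (go t a)

-- This is `1/(1 - zT) = 1 + zT/(1 - zT)` for the first entry.
U-𝟙-step : ∀ f a x v → U 𝟙 (suc a) f (suc x ∷ v) ≡ U 𝟙 (suc a) (λ d → f (suc x ∷ d)) v +ℤ U 𝟙 a f (x ∷ v)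
U-𝟙-step f a x v = cong (_+ℤ U 𝟙 a f (x ∷ v)) (ℤₚ.*-identityˡ (U 𝟙 (suc a) (λ d → f (suc x ∷ d)) v))

U-𝟙-restrict : ∀ f z v → (∀ a → U 𝟙 a f (z ∷ v) ≡ U 𝟙 a (λ d → f (z ∷ d)) v) → ∀ t a →
  U 𝟙 a f (t + z ∷ v) ≡ anti≤ t a (λ j r → U 𝟙 r (λ d → f (t + z ∸ j ∷ d)) v)
U-𝟙-restrict f z v h zero    a       = h a
U-𝟙-restrict f z v h (suc t) zero    = ℤₚ.*-identityˡ _
U-𝟙-restrict f z v h (suc t) (suc a) = trans (U-𝟙-step f a (t + z) v)
  (cong (U 𝟙 (suc a) (λ d → f (suc t + z ∷ d)) v +ℤ_) (U-𝟙-restrict f z v h t a))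

-- Lowering the first entry to at most the second one contributes nothing: the
-- total of these terms is the value of an alternating function at equal entries.
U-𝟙-bottom : ∀ {f} → Alternating f → ∀ ν a →
  U 𝟙 a f (part ν 0 + length ν ∷ β ν) ≡ U 𝟙 a (λ d → f (part ν 0 + length ν ∷ d)) (β ν)
U-𝟙-bottom {f} af []      zero    = ℤₚ.*-identityˡ _
U-𝟙-bottom {f} af []      (suc a) = trans (cong (1ℤ *ℤ (0ℤ *ℤ f (0 ∷ [])) +ℤ_) (anti-0 a)) refl
U-𝟙-bottom {f} af (y ∷ ν) a = subst (λ z → U 𝟙 a f (z ∷ β (y ∷ ν)) ≡ U 𝟙 a (λ d → f (z ∷ d)) (β (y ∷ ν)))
  (sym (ℕₚ.+-suc y (length ν))) (lem a)
  where
  lem : ∀ a → U 𝟙 a f (suc (y + length ν) ∷ β (y ∷ ν)) ≡ U 𝟙 a (λ d → f (suc (y + length ν) ∷ d)) (β (y ∷ ν))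
  lem zero    = ℤₚ.*-identityˡ _
  lem (suc a) = trans (U-𝟙-step f a (y + length ν) (β (y ∷ ν)))
    (trans (cong (U 𝟙 (suc a) (λ d → f (suc (y + length ν) ∷ d)) (β (y ∷ ν)) +ℤ_)
      (alternating-repeat {U 𝟙 a f} (U-alternating 𝟙 a {f} af) [] (y + length ν) (β ν))) (ℤₚ.+-identityʳ _))

-- `U 𝟙` shortens the rows without restriction, whereas in a strip no row may become shorter than
-- the next row of `ν`. By `U-𝟙-bottom` the excess terms cancel, and the recursion that is left is
-- that of `strip-∷`.
pieri : ∀ {f} → Alternating f → ∀ ν → Decreasing ν → ∀ a → U 𝟙 a f (β ν) ≡ strip (λ ρ → f (β ρ)) ν a
pieri {f} af [] _ zero    = trans (ℤₚ.*-identityˡ _) (sym (ℤₚ.+-identityʳ _))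
pieri {f} af [] _ (suc a) = refl
pieri {f} af (x ∷ ν) (ν₀≤x , dν) a = subst (λ x → U 𝟙 a f (β (x ∷ ν)) ≡ strip (λ ρ → f (β ρ)) (x ∷ ν) a)
  (ℕₚ.m∸n+n≡m ν₀≤x) (begin
  U 𝟙 a f (t + z + ℓ ∷ β ν)
    ≡⟨ cong (λ y → U 𝟙 a f (y ∷ β ν)) (ℕₚ.+-assoc t z ℓ) ⟩
  U 𝟙 a f (t + (z + ℓ) ∷ β ν)
    ≡⟨ U-𝟙-restrict f (z + ℓ) (β ν) (U-𝟙-bottom {f} af ν) t a ⟩
  anti≤ t a (λ j r → U 𝟙 r (λ d → f (t + (z + ℓ) ∸ j ∷ d)) (β ν))
    ≡⟨ anti≤-cong t a (λ j r j≤t _ → trans (pieri (alternating-∷ {f} (t + (z + ℓ) ∸ j) af) ν dν r)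
         (lsum-cong (horizontalStrips ν) λ ρ ρ∈ → cong (λ y → when (r + sum ρ) (sum ν) (f (y ∷ β ρ)))
           (trans (cong (_∸ j) (sym (ℕₚ.+-assoc t z ℓ)))
             (trans (ℕₚ.+-∸-comm ℓ (ℕₚ.≤-trans j≤t (ℕₚ.m≤m+n t z)))
               (cong (t + z ∸ j +_) (sym (proj₁ (strips-∈ ν ρ∈)))))))) ⟩
  anti≤ t a (λ j r → strip (λ ρ → f (β (t + z ∸ j ∷ ρ))) ν r)
    ≡⟨ strip-∷ (λ ρ → f (β ρ)) t ν a ⟨
  strip (λ ρ → f (β ρ)) (t + z ∷ ν) a ∎)
  where
  z t ℓ : ℕ
  z = part ν 0
  t = x ∸ z
  ℓ = length ν

countTableaux-∷ : ∀ ν a γ → pos (countTableaux ν (a ∷ γ)) ≡ strip (λ ρ → pos (countTableaux ρ γ)) ν a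
countTableaux-∷ ν a γ = lsum-filter (λ ρ → countTableaux ρ γ) (λ ρ → a + sum ρ) (sum ν) (horizontalStrips ν)

-- The cells with the largest entry form a horizontal strip, so by `pieri` both sides obey the same
-- recursion. Strips keep the number of rows, hence the columns of `κ-det` never change along it.
jacobi-trudi : ∀ γ ν → Decreasing ν →
  pos (countTableaux ν γ) ≡ E 𝟙 (κ-det (downFrom (length ν))) γ (β ν)
jacobi-trudi []      ν dν = trans (lem (does (sum ν ≟ 0))) (sym (κ-det-β ν))
  where
  lem : ∀ b → pos (if b then 1 else 0) ≡ (if b then 1ℤ else 0ℤ)
  lem true  = refl
  lem false = refl
jacobi-trudi (a ∷ γ) ν dν = begin
  pos (countTableaux ν (a ∷ γ))
    ≡⟨ countTableaux-∷ ν a γ ⟩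
  strip (λ ρ → pos (countTableaux ρ γ)) ν a
    ≡⟨ lsum-cong (horizontalStrips ν) (λ ρ ρ∈ → cong (when (a + sum ρ) (sum ν)) (
         trans (jacobi-trudi γ ρ (proj₂ (proj₂ (proj₂ (strips-∈ ν ρ∈)))))
           (cong (λ ℓ → E 𝟙 (κ-det (downFrom ℓ)) γ (β ρ)) (proj₁ (strips-∈ ν ρ∈))))) ⟩
  strip (λ ρ → E 𝟙 (κ-det (downFrom (length ν))) γ (β ρ)) ν a
    ≡⟨ pieri (E-alternating 𝟙 γ (κ-det-alternating (downFrom (length ν)))) ν dν a ⟨
  E 𝟙 (κ-det (downFrom (length ν))) (a ∷ γ) (β ν) ∎

-- Products of power series and the Petrie generating function

*ˢ-∷ : ∀ f g a α → (f *ˢ g) (a ∷ α) ≡ anti a (λ i j → ((λ γ → f (i ∷ γ)) *ˢ (λ γ → g (j ∷ γ))) α)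
*ˢ-∷ f g a α = trans (cong (foldr _+ℤ_ 0ℤ) (Listₚ.map-upTo (λ i → F i (a ∸ i)) (suc a)))
  (lem a F)
  where
  F : ℕ → ℕ → ℤ
  F i j = ((λ γ → f (i ∷ γ)) *ˢ (λ γ → g (j ∷ γ))) α
  lem : ∀ n F → foldr _+ℤ_ 0ℤ (applyUpTo (λ i → F i (n ∸ i)) (suc n)) ≡ anti n F
  lem zero    F = ℤₚ.+-identityʳ (F 0 0)
  lem (suc n) F = cong (F 0 (suc n) +ℤ_) (lem n (λ i → F (suc i)))

*ˢ-cong : ∀ {f f′ g g′ : Series} → (∀ α → f α ≡ f′ α) → (∀ α → g α ≡ g′ α) → ∀ α → (f *ˢ g) α ≡ (f′ *ˢ g′) α
*ˢ-cong ef eg []      = cong₂ _*ℤ_ (ef []) (eg [])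
*ˢ-cong {f} {f′} {g} {g′} ef eg (a ∷ α) = trans (*ˢ-∷ f g a α) (trans
  (anti-cong a λ i j _ → *ˢ-cong (λ γ → ef (i ∷ γ)) (λ γ → eg (j ∷ γ)) α) (sym (*ˢ-∷ f′ g′ a α)))

through-*ʳ : ∀ {L : (A → ℤ) → ℤ} → IsLinear L → ∀ (f : Series) (g : A → Series) α →
  L (λ a → (f *ˢ g a) α) ≡ (f *ˢ (λ γ → L (λ a → g a γ))) α
through-*ʳ {L = L} lin f g []      = scale lin (f []) (λ a → g a [])
through-*ʳ {L = L} lin f g (x ∷ α) = trans (ext lin λ a → *ˢ-∷ f (g a) x α) (trans (through-anti lin x _)
  (trans (anti-cong x λ i j _ → through-*ʳ lin (λ γ → f (i ∷ γ)) (λ a γ → g a (j ∷ γ)) α) (sym (*ˢ-∷ f (λ γ → L (λ a → g a γ)) x α))))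

through-*ˡ : ∀ {L : (A → ℤ) → ℤ} → IsLinear L → ∀ (f : A → Series) (g : Series) α →
  L (λ a → (f a *ˢ g) α) ≡ ((λ γ → L (λ a → f a γ)) *ˢ g) α
through-*ˡ {L = L} lin f g []      = trans (ext lin λ a → ℤₚ.*-comm (f a []) (g []))
  (trans (scale lin (g []) (λ a → f a [])) (ℤₚ.*-comm (g []) _))
through-*ˡ {L = L} lin f g (x ∷ α) = trans (ext lin λ a → *ˢ-∷ (f a) g x α) (trans (through-anti lin x _)
  (trans (anti-cong x λ i j _ → through-*ˡ lin (λ a γ → f a (i ∷ γ)) (λ γ → g (j ∷ γ)) α) (sym (*ˢ-∷ (λ γ → L (λ a → f a γ)) g x α))))

scale-linear : ∀ {L : (A → ℤ) → ℤ} → IsLinear L → ∀ c → IsLinear (λ f → c *ℤ L f)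
scale-linear {L = L} lin c = record
  { ext   = λ e → cong (c *ℤ_) (ext lin e)
  ; plus  = λ f g → trans (cong (c *ℤ_) (plus lin f g)) (ℤₚ.*-distribˡ-+ c (L f) (L g))
  ; scale = λ k f → trans (cong (c *ℤ_) (scale lin k f)) (*ℤ-swap c k (L f))
  }

eval-linear : ∀ (a : A) → IsLinear (λ f → f a)
eval-linear a = record { ext = λ e → e a ; plus = λ _ _ → refl ; scale = λ _ _ → refl }

*ˢ-scaleˡ : ∀ c (f g : Series) α → ((λ γ → c *ℤ f γ) *ˢ g) α ≡ c *ℤ (f *ˢ g) α
*ˢ-scaleˡ c f g α = sym (through-*ˡ (scale-linear (eval-linear tt) c) (λ _ → f) g α)

*ˢ-scaleʳ : ∀ c (f g : Series) α → (f *ˢ (λ γ → c *ℤ g γ)) α ≡ c *ℤ (f *ˢ g) α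
*ˢ-scaleʳ c f g α = sym (through-*ʳ (scale-linear (eval-linear tt) c) f (λ _ → g) α)

-- Multiplying a series by `z^c` shifts its coefficients.
anti-κ : ∀ n c (X : ℕ → ℤ) → anti n (λ i j → κ i c *ℤ X j) ≡ sh c n X
anti-κ zero    zero    X = ℤₚ.*-identityˡ (X 0)
anti-κ zero    (suc c) X = refl
anti-κ (suc n) zero    X = trans (cong₂ _+ℤ_ (ℤₚ.*-identityˡ (X (suc n))) (anti-0 n)) (ℤₚ.+-identityʳ _)
anti-κ (suc n) (suc c) X = trans (ℤₚ.+-identityˡ _) (anti-κ n c X)

1ˢ-∷ : ∀ a α → 1ˢ (a ∷ α) ≡ κ a 0 *ℤ 1ˢ α
1ˢ-∷ zero    α = sym (ℤₚ.*-identityˡ (1ˢ α))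
1ˢ-∷ (suc a) α = refl

*ˢ-identityˡ : ∀ g α → (1ˢ *ˢ g) α ≡ g α
*ˢ-identityˡ g []      = ℤₚ.*-identityˡ (g [])
*ˢ-identityˡ g (a ∷ α) = begin
  (1ˢ *ˢ g) (a ∷ α)                                         ≡⟨ *ˢ-∷ 1ˢ g a α ⟩
  anti a (λ i j → ((λ γ → 1ˢ (i ∷ γ)) *ˢ (λ γ → g (j ∷ γ))) α)
    ≡⟨ anti-cong a (λ i j _ → trans (*ˢ-cong {g = λ γ → g (j ∷ γ)} (1ˢ-∷ i) (λ _ → refl) α) (trans (*ˢ-scaleˡ (κ i 0) 1ˢ _ α)
         (cong (κ i 0 *ℤ_) (*ˢ-identityˡ (λ γ → g (j ∷ γ)) α)))) ⟩
  anti a (λ i j → κ i 0 *ℤ g (j ∷ α))                       ≡⟨ anti-κ a 0 (λ j → g (j ∷ α)) ⟩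
  g (a ∷ α)                                                 ∎

*ˢ-∷∷ : ∀ f g m a α → (f *ˢ g) (m ∷ a ∷ α) ≡
  anti m (λ i j → anti a (λ b c → ((λ γ → f (i ∷ b ∷ γ)) *ˢ (λ γ → g (j ∷ c ∷ γ))) α))
*ˢ-∷∷ f g m a α = trans (*ˢ-∷ f g m (a ∷ α)) (anti-cong m λ i j _ → *ˢ-∷ (λ γ → f (i ∷ γ)) (λ γ → g (j ∷ γ)) a α)

-- f′ is f with a fresh variable inserted after the first one.
Lifts : Series → Series → Set
Lifts f f′ = ∀ m a α → f′ (m ∷ a ∷ α) ≡ κ a 0 *ℤ f (m ∷ α)

lifts-* : ∀ f f′ g g′ → Lifts f f′ → Lifts g g′ → Lifts (f *ˢ g) (f′ *ˢ g′)
lifts-* f f′ g g′ lf lg m a α = begin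
  (f′ *ˢ g′) (m ∷ a ∷ α)
    ≡⟨ *ˢ-∷∷ f′ g′ m a α ⟩
  anti m (λ i j → anti a (λ b c → ((λ γ → f′ (i ∷ b ∷ γ)) *ˢ (λ γ → g′ (j ∷ c ∷ γ))) α))
    ≡⟨ anti-cong m (λ i j _ → trans (anti-cong a λ b c _ → trans (*ˢ-cong (lf i b) (lg j c) α)
         (trans (*ˢ-scaleˡ (κ b 0) (λ γ → f (i ∷ γ)) _ α) (cong (κ b 0 *ℤ_)
           (*ˢ-scaleʳ (κ c 0) (λ γ → f (i ∷ γ)) (λ γ → g (j ∷ γ)) α))))
         (anti-κ a 0 (λ c → κ c 0 *ℤ ((λ γ → f (i ∷ γ)) *ˢ (λ γ → g (j ∷ γ))) α))) ⟩
  anti m (λ i j → κ a 0 *ℤ ((λ γ → f (i ∷ γ)) *ˢ (λ γ → g (j ∷ γ))) α)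
    ≡⟨ anti-* m (κ a 0) _ ⟩
  κ a 0 *ℤ anti m (λ i j → ((λ γ → f (i ∷ γ)) *ˢ (λ γ → g (j ∷ γ))) α)
    ≡⟨ cong (κ a 0 *ℤ_) (*ˢ-∷ f g m α) ⟨
  κ a 0 *ℤ (f *ˢ g) (m ∷ α) ∎

lifts-1 : Lifts 1ˢ 1ˢ
lifts-1 m a α = trans (1ˢ-∷ m (a ∷ α)) (trans (cong (κ m 0 *ℤ_) (1ˢ-∷ a α))
  (trans (*ℤ-swap (κ m 0) (κ a 0) (1ˢ α)) (cong (κ a 0 *ℤ_) (sym (1ˢ-∷ m α)))))

lifts-^ : ∀ f f′ → Lifts f f′ → ∀ j → Lifts (f ^ j) (f′ ^ j)
lifts-^ f f′ lf zero    = lifts-1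
lifts-^ f f′ lf (suc j) = lifts-* f f′ (f ^ j) (f′ ^ j) lf (lifts-^ f f′ lf j)

lifts-∑ : ∀ n (f f′ : Fin n → Series) → (∀ i → Lifts (f i) (f′ i)) → Lifts (∑ f) (∑ f′)
lifts-∑ zero    f f′ lf m a α = sym (ℤₚ.*-zeroʳ (κ a 0))
lifts-∑ (suc n) f f′ lf m a α = trans (cong₂ _+ℤ_ (lf zero m a α) (lifts-∑ n (f ∘ suc) (f′ ∘ suc) (λ i → lf (suc i)) m a α))
  (sym (ℤₚ.*-distribˡ-+ (κ a 0) (f zero (m ∷ α)) _))

lifts-∏ : ∀ n (f f′ : Fin n → Series) → (∀ i → Lifts (f i) (f′ i)) → Lifts (∏ f) (∏ f′)
lifts-∏ zero    f f′ lf = lifts-1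
lifts-∏ (suc n) f f′ lf =
  lifts-* (f zero) (f′ zero) (∏ (f ∘ suc)) (∏ (f′ ∘ suc)) (lf zero) (lifts-∏ n (f ∘ suc) (f′ ∘ suc) λ i → lf (suc i))

lifts-var : ∀ i → Lifts (var (suc i)) (var (suc (suc i)))
lifts-var i zero    zero    α = sym (ℤₚ.*-identityˡ _)
lifts-var i zero    (suc a) α = refl
lifts-var i (suc m) a       α = sym (ℤₚ.*-zeroʳ (κ a 0))

var-0 : ∀ m α → var 0 (m ∷ α) ≡ κ m 1 *ℤ 1ˢ α
var-0 zero          α = refl
var-0 (suc zero)    α = sym (ℤₚ.*-identityˡ _)
var-0 (suc (suc m)) α = refl

lifts-var-0 : Lifts (var 0) (var 0)
lifts-var-0 m a α = trans (var-0 m (a ∷ α)) (trans (cong (κ m 1 *ℤ_) (1ˢ-∷ a α))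
  (trans (*ℤ-swap (κ m 1) (κ a 0) (1ˢ α)) (cong (κ a 0 *ℤ_) (sym (var-0 m α)))))

Monomial : ℕ → ℕ → Series → Set
Monomial c d f = ∀ m a α → f (m ∷ a ∷ α) ≡ κ m c *ℤ (κ a d *ℤ 1ˢ α)

sh-κ : ∀ c d m → sh c m (λ m′ → κ m′ d) ≡ κ m (c + d)
sh-κ zero    d m       = refl
sh-κ (suc c) d zero    = refl
sh-κ (suc c) d (suc m) = sh-κ c d m

monomial-* : ∀ {c d c′ d′} f g → Monomial c d f → Monomial c′ d′ g → Monomial (c + c′) (d + d′) (f *ˢ g)
monomial-* {c} {d} {c′} {d′} f g mf mg m a α = begin
  (f *ˢ g) (m ∷ a ∷ α)
    ≡⟨ *ˢ-∷∷ f g m a α ⟩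
  anti m (λ i j → anti a (λ b e → ((λ γ → f (i ∷ b ∷ γ)) *ˢ (λ γ → g (j ∷ e ∷ γ))) α))
    ≡⟨ anti-cong m (λ i j _ → trans (anti-cong a λ b e _ → begin
         ((λ γ → f (i ∷ b ∷ γ)) *ˢ (λ γ → g (j ∷ e ∷ γ))) α
           ≡⟨ *ˢ-cong (mf i b) (mg j e) α ⟩
         ((λ γ → κ i c *ℤ (κ b d *ℤ 1ˢ γ)) *ˢ (λ γ → κ j c′ *ℤ (κ e d′ *ℤ 1ˢ γ))) α
           ≡⟨ trans (*ˢ-scaleˡ (κ i c) (λ γ → κ b d *ℤ 1ˢ γ) _ α)
                (cong (κ i c *ℤ_) (trans (*ˢ-scaleˡ (κ b d) 1ˢ _ α)
                  (cong (κ b d *ℤ_) (*ˢ-identityˡ (λ γ → κ j c′ *ℤ (κ e d′ *ℤ 1ˢ γ)) α)))) ⟩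
         κ i c *ℤ (κ b d *ℤ (κ j c′ *ℤ (κ e d′ *ℤ 1ˢ α)))
           ≡⟨ rearrange (κ i c) (κ b d) (κ j c′) (κ e d′) (1ˢ α) ⟩
         κ i c *ℤ (κ j c′ *ℤ 1ˢ α) *ℤ (κ b d *ℤ κ e d′) ∎)
         (trans (anti-* a (κ i c *ℤ (κ j c′ *ℤ 1ˢ α)) _) (cong (κ i c *ℤ (κ j c′ *ℤ 1ˢ α) *ℤ_)
           (trans (anti-κ a d (λ e → κ e d′)) (sh-κ d d′ a))))) ⟩
  anti m (λ i j → κ i c *ℤ (κ j c′ *ℤ 1ˢ α) *ℤ κ a (d + d′))
    ≡⟨ anti-cong m (λ i j _ → rearrange′ (κ i c) (κ j c′) (1ˢ α) (κ a (d + d′))) ⟩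
  anti m (λ i j → κ a (d + d′) *ℤ 1ˢ α *ℤ (κ i c *ℤ κ j c′))
    ≡⟨ trans (anti-* m (κ a (d + d′) *ℤ 1ˢ α) _) (cong (κ a (d + d′) *ℤ 1ˢ α *ℤ_)
         (trans (anti-κ m c (λ j → κ j c′)) (sh-κ c c′ m))) ⟩
  κ a (d + d′) *ℤ 1ˢ α *ℤ κ m (c + c′)
    ≡⟨ ℤₚ.*-comm (κ a (d + d′) *ℤ 1ˢ α) (κ m (c + c′)) ⟩
  κ m (c + c′) *ℤ (κ a (d + d′) *ℤ 1ˢ α) ∎
  where
  rearrange : ∀ p q r s t → p *ℤ (q *ℤ (r *ℤ (s *ℤ t))) ≡ p *ℤ (r *ℤ t) *ℤ (q *ℤ s)
  rearrange = solve-∀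
  rearrange′ : ∀ p r t y → p *ℤ (r *ℤ t) *ℤ y ≡ y *ℤ t *ℤ (p *ℤ r)
  rearrange′ = solve-∀

monomial-1 : Monomial 0 0 1ˢ
monomial-1 m a α = trans (1ˢ-∷ m (a ∷ α)) (cong (κ m 0 *ℤ_) (1ˢ-∷ a α))

monomial-var-0 : Monomial 1 0 (var 0)
monomial-var-0 m a α = trans (var-0 m (a ∷ α)) (cong (κ m 1 *ℤ_) (1ˢ-∷ a α))

monomial-var-1 : Monomial 0 1 (var 1)
monomial-var-1 zero    a α = trans (var-0 a α) (sym (ℤₚ.*-identityˡ _))
monomial-var-1 (suc m) a α = refl

monomial-^ : ∀ j → Monomial j j ((var 1 *ˢ var 0) ^ j)
monomial-^ zero    = monomial-1
monomial-^ (suc j) = monomial-* (var 1 *ˢ var 0) ((var 1 *ˢ var 0) ^ j)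
  (monomial-* (var 1) (var 0) monomial-var-1 monomial-var-0) (monomial-^ j)

∑-κ : ∀ k (F : ℕ → Series) α a (h : ℕ → ℤ) → (∀ j → F j α ≡ κ a j *ℤ h j) →
  (∑ λ (j : Fin k) → F (toℕ j)) α ≡ below k a *ℤ h a
∑-κ zero    F α a       h e = refl
∑-κ (suc k) F α zero    h e = trans (cong₂ _+ℤ_ (e 0) (zeros k (F ∘ suc) (λ j → e (suc j)))) (ℤₚ.+-identityʳ _)
  where
  zeros : ∀ k (F : ℕ → Series) → (∀ j → F j α ≡ 0ℤ) → (∑ λ (j : Fin k) → F (toℕ j)) α ≡ 0ℤ
  zeros zero    F e = refl
  zeros (suc k) F e = cong₂ _+ℤ_ (e 0) (zeros k (F ∘ suc) (λ j → e (suc j)))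
∑-κ (suc k) F α (suc a) h e = trans (cong₂ _+ℤ_ (e 0) (∑-κ k (F ∘ suc) α a (h ∘ suc) (λ j → e (suc j)))) (ℤₚ.+-identityˡ _)

-- Only the first factor involves the first `x`-variable, and there its power `a` comes with `z^a`
-- and requires `a < k`. The other factors must supply the remaining power of `z`.
petrieGen-∷ : ∀ k n m a α → petrieGen k (suc n) (m ∷ a ∷ α) ≡
  below k a *ℤ sh a m (λ m′ → petrieGen k n (m′ ∷ α))
petrieGen-∷ k n m a α = begin
  (S *ˢ R) (m ∷ a ∷ α)
    ≡⟨ *ˢ-∷∷ S R m a α ⟩
  anti m (λ i j → anti a (λ b c → ((λ γ → S (i ∷ b ∷ γ)) *ˢ (λ γ → R (j ∷ c ∷ γ))) α))
    ≡⟨ anti-cong m (λ i j _ → trans (anti-cong a λ b c _ → begin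
         ((λ γ → S (i ∷ b ∷ γ)) *ˢ (λ γ → R (j ∷ c ∷ γ))) α
           ≡⟨ *ˢ-cong (S-∷∷ i b) (R-lifts j c) α ⟩
         ((λ γ → below k b *ℤ (κ i b *ℤ 1ˢ γ)) *ˢ (λ γ → κ c 0 *ℤ petrieGen k n (j ∷ γ))) α
           ≡⟨ trans (*ˢ-scaleˡ (below k b) (λ γ → κ i b *ℤ 1ˢ γ) _ α)
                (cong (below k b *ℤ_) (trans (*ˢ-scaleˡ (κ i b) 1ˢ _ α)
                  (cong (κ i b *ℤ_) (*ˢ-identityˡ (λ γ → κ c 0 *ℤ petrieGen k n (j ∷ γ)) α)))) ⟩
         below k b *ℤ (κ i b *ℤ (κ c 0 *ℤ petrieGen k n (j ∷ α)))
           ≡⟨ rearrange (below k b) (κ i b) (κ c 0) (petrieGen k n (j ∷ α)) ⟩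
         κ c 0 *ℤ (below k b *ℤ (κ i b *ℤ petrieGen k n (j ∷ α))) ∎)
         (trans (anti-comm a _) (anti-κ a 0 (λ b → below k b *ℤ (κ i b *ℤ petrieGen k n (j ∷ α)))))) ⟩
  anti m (λ i j → below k a *ℤ (κ i a *ℤ petrieGen k n (j ∷ α)))
    ≡⟨ anti-* m (below k a) _ ⟩
  below k a *ℤ anti m (λ i j → κ i a *ℤ petrieGen k n (j ∷ α))
    ≡⟨ cong (below k a *ℤ_) (anti-κ m a _) ⟩
  below k a *ℤ sh a m (λ m′ → petrieGen k n (m′ ∷ α)) ∎
  where
  rearrange : ∀ p q r s → p *ℤ (q *ℤ (r *ℤ s)) ≡ r *ℤ (p *ℤ (q *ℤ s))
  rearrange = solve-∀

  S R : Series
  S = ∑ λ (j : Fin k) → (var 1 *ˢ var 0) ^ toℕ j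
  R = ∏ λ (i : Fin n) → ∑ λ (j : Fin k) → (var (suc (suc (toℕ i))) *ˢ var 0) ^ toℕ j

  R-lifts : Lifts (petrieGen k n) R
  R-lifts = lifts-∏ n _ _ λ i → lifts-∑ k _ _ λ j →
    lifts-^ (var (suc (toℕ i)) *ˢ var 0) (var (suc (suc (toℕ i))) *ˢ var 0)
      (lifts-* (var (suc (toℕ i))) (var (suc (suc (toℕ i)))) (var 0) (var 0) (lifts-var (toℕ i)) lifts-var-0) (toℕ j)

  S-∷∷ : ∀ m a α → S (m ∷ a ∷ α) ≡ below k a *ℤ (κ m a *ℤ 1ˢ α)
  S-∷∷ m a α = ∑-κ k (λ j → (var 1 *ˢ var 0) ^ j) (m ∷ a ∷ α) a (λ j → κ m j *ℤ 1ˢ α)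
    (λ j → trans (monomial-^ j m a α) (*ℤ-swap (κ m j) (κ a j) (1ˢ α)))

-- The determinant of a modular Schur function

sh-suc : ∀ i x (H : ℕ → ℤ) → H 0 ≡ 0ℤ → sh i (suc x) H ≡ sh i x (λ y → H (suc y))
sh-suc zero          x       H e = refl
sh-suc (suc zero)    zero    H e = e
sh-suc (suc (suc i)) zero    H e = refl
sh-suc (suc i)       (suc x) H e = sh-suc i x H e

entry : ℕ → ℕ → ℕ → Series
entry k x y = petrieℤ k (x ⊖ y)

entry-[] : ∀ k x y → entry k x y [] ≡ κ x y
entry-[] k zero    zero    = refl
entry-[] k (suc x) zero    = refl
entry-[] k zero    (suc y) = refl
entry-[] k (suc x) (suc y) = trans (cong (λ z → petrieℤ k z []) (ℤₚ.[1+m]⊖[1+n]≡m⊖n x y)) (entry-[] k x y)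

-- The shift truncates at row index 0 and not at degree 0. This does no harm: an index below `y` has
-- negative degree, where the Petrie function vanishes anyway.
entry-∷ : ∀ k x y i γ → entry k x y (i ∷ γ) ≡ below k i *ℤ sh i x (λ x′ → entry k x′ y γ)
entry-∷ k x       zero    i       γ = petrieGen-∷ k (length γ) x i γ
entry-∷ k zero    (suc y) zero    γ = sym (ℤₚ.*-zeroʳ (below k 0))
entry-∷ k zero    (suc y) (suc i) γ = sym (ℤₚ.*-zeroʳ (below k (suc i)))
entry-∷ k (suc x) (suc y) i       γ = begin
  entry k (suc x) (suc y) (i ∷ γ)                                   ≡⟨ cong (λ z → petrieℤ k z (i ∷ γ)) (ℤₚ.[1+m]⊖[1+n]≡m⊖n x y) ⟩
  entry k x y (i ∷ γ)                                               ≡⟨ entry-∷ k x y i γ ⟩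
  below k i *ℤ sh i x (λ x′ → entry k x′ y γ)
    ≡⟨ cong (below k i *ℤ_) (sh-cong i x λ x′ → cong (λ z → petrieℤ k z γ) (ℤₚ.[1+m]⊖[1+n]≡m⊖n x′ y)) ⟨
  below k i *ℤ sh i x (λ x′ → entry k (suc x′) (suc y) γ)
    ≡⟨ cong (below k i *ℤ_) (sh-suc i x (λ x′ → entry k x′ (suc y) γ) refl) ⟨
  below k i *ℤ sh i (suc x) (λ x′ → entry k x′ (suc y) γ)           ∎

petrieDet : ℕ → List ℕ → List ℕ → Series
petrieDet k q []        = 1ˢ
petrieDet k q (x ∷ v) γ = alt (λ y r → (entry k x y *ˢ petrieDet k r v) γ) q

petrieDet-[] : ∀ k q b → petrieDet k q b [] ≡ κ-det q b
petrieDet-[] k q []      = refl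
petrieDet-[] k q (x ∷ v) = alt-cong q λ y r → cong₂ _*ℤ_ (entry-[] k x y) (petrieDet-[] k r v)

-- By `entry-∷` a new variable acts on all entries of a row through one operator, independent of the
-- column. Multilinearity in the rows therefore takes these operators out of the determinant.
petrieDet-∷ : ∀ k q b c γ → petrieDet k q b (c ∷ γ) ≡ U (below k) c (λ d → petrieDet k q d γ) b
petrieDet-∷ k q []      c γ = 1ˢ-∷ c γ
petrieDet-∷ k q (x ∷ v) c γ = begin
  alt (λ y r → (entry k x y *ˢ petrieDet k r v) (c ∷ γ)) q
    ≡⟨ alt-cong q expand ⟩
  alt (λ y r → anti c (λ i j → below k i *ℤ sh i x (λ x′ → U (below k) j (λ d → T x′ d y r) v))) q
    ≡⟨ through-anti lin c _ ⟩
  anti c (λ i j → alt (λ y r → below k i *ℤ sh i x (λ x′ → U (below k) j (λ d → T x′ d y r) v)) q)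
    ≡⟨ anti-cong c (λ i j _ → trans (scale lin (below k i) _) (cong (below k i *ℤ_)
         (trans (through-sh lin i x λ { x′ (y , r) → U (below k) j (λ d → T x′ d y r) v })
           (sh-cong i x λ x′ → through-U lin (below k) j v λ { d (y , r) → T x′ d y r })))) ⟩
  anti c (λ i j → below k i *ℤ sh i x (λ x′ → U (below k) j (λ d → petrieDet k q (x′ ∷ d) γ) v)) ∎
  where
  lin : IsLinear (λ (F : ℕ × List ℕ → ℤ) → alt (λ y r → F (y , r)) q)
  lin = alt-linear q

  T : ℕ → List ℕ → ℕ → List ℕ → ℤ
  T x′ d y r = (entry k x′ y *ˢ petrieDet k r d) γ

  expand : ∀ y r → (entry k x y *ˢ petrieDet k r v) (c ∷ γ) ≡
    anti c (λ i j → below k i *ℤ sh i x (λ x′ → U (below k) j (λ d → T x′ d y r) v))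
  expand y r = trans (*ˢ-∷ (entry k x y) (petrieDet k r v) c γ) (anti-cong c λ i j _ →
    trans (*ˢ-cong (entry-∷ k x y i) (petrieDet-∷ k r v j) γ)
    (trans (sym (through-*ˡ (scale-linear (sh-linear i x) (below k i)) (λ x′ → entry k x′ y) _ γ))
      (cong (below k i *ℤ_) (sh-cong i x λ x′ →
        sym (through-*ʳ (U-linear (below k) j v) (entry k x′ y) (petrieDet k r) γ)))))

petrieDet-E : ∀ k q γ b → petrieDet k q b γ ≡ E (below k) (κ-det q) γ b
petrieDet-E k q []      b = petrieDet-[] k q b
petrieDet-E k q (c ∷ γ) b = trans (petrieDet-∷ k q b c γ) (U-cong (below k) c b (petrieDet-E k q γ))

sgn : ℕ → ℤ
sgn zero    = 1ℤ
sgn (suc j) = -ℤ sgn j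

-1ˢ^ : ∀ j γ → ((-ˢ 1ˢ) ^ j) γ ≡ sgn j *ℤ 1ˢ γ
-1ˢ^ zero    γ = sym (ℤₚ.*-identityˡ (1ˢ γ))
-1ˢ^ (suc j) γ = begin
  ((-ˢ 1ˢ) *ˢ ((-ˢ 1ˢ) ^ j)) γ
    ≡⟨ *ˢ-cong {g = (-ˢ 1ˢ) ^ j} (λ γ → sym (ℤₚ.-1*i≡-i (1ˢ γ))) (λ _ → refl) γ ⟩
  ((λ γ → -ℤ 1ℤ *ℤ 1ˢ γ) *ˢ ((-ˢ 1ˢ) ^ j)) γ
    ≡⟨ *ˢ-scaleˡ (-ℤ 1ℤ) 1ˢ ((-ˢ 1ˢ) ^ j) γ ⟩
  -ℤ 1ℤ *ℤ (1ˢ *ˢ ((-ˢ 1ˢ) ^ j)) γ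
    ≡⟨ cong (-ℤ 1ℤ *ℤ_) (trans (*ˢ-identityˡ ((-ˢ 1ˢ) ^ j) γ) (-1ˢ^ j γ)) ⟩
  -ℤ 1ℤ *ℤ (sgn j *ℤ 1ˢ γ)
    ≡⟨ trans (ℤₚ.-1*i≡-i _) (ℤₚ.neg-distribˡ-* (sgn j) (1ˢ γ)) ⟩
  sgn (suc j) *ℤ 1ˢ γ ∎

-- The factor `c` makes the induction possible: passing over a column turns it into `-c` and returns
-- that column to the remaining ones.
∑-alt : ∀ n (q : Fin (suc n) → ℕ) c (Φ : ℕ → List ℕ → ℤ) (T : Fin (suc n) → Series) γ →
  (∀ j → T j γ ≡ c *ℤ (sgn (toℕ j) *ℤ Φ (q j) (tabulate (q ∘ punchIn j)))) →
  (∑ T) γ ≡ c *ℤ alt Φ (tabulate q)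
∑-alt n q c Φ T γ e = trans (cong₂ _+ℤ_ (e zero) (rest n q T e)) (lem c (Φ (q zero) (tabulate (q ∘ suc))) _)
  where
  lem : ∀ c a b → c *ℤ (1ℤ *ℤ a) +ℤ -ℤ c *ℤ b ≡ c *ℤ (a -ℤ b)
  lem = solve-∀
  lem′ : ∀ c s a → c *ℤ (-ℤ s *ℤ a) ≡ -ℤ c *ℤ (s *ℤ a)
  lem′ = solve-∀
  rest : ∀ n (q : Fin (suc n) → ℕ) (T : Fin (suc n) → Series) →
    (∀ j → T j γ ≡ c *ℤ (sgn (toℕ j) *ℤ Φ (q j) (tabulate (q ∘ punchIn j)))) →
    (∑ (T ∘ suc)) γ ≡ -ℤ c *ℤ alt (λ z r → Φ z (q zero ∷ r)) (tabulate (q ∘ suc))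
  rest zero    q T e = sym (ℤₚ.*-zeroʳ (-ℤ c))
  rest (suc n) q T e = ∑-alt n (q ∘ suc) (-ℤ c) (λ z r → Φ z (q zero ∷ r)) (T ∘ suc) γ
    (λ j → trans (e (suc j)) (lem′ c (sgn (toℕ j)) _))

det-petrieDet : ∀ k n (A : Fin n → Fin n → Series) (r q : Fin n → ℕ) → (∀ i j → A i j ≡ entry k (r i) (q j)) →
  ∀ γ → det seriesRing n A γ ≡ petrieDet k (tabulate q) (tabulate r) γ
det-petrieDet k zero    A r q e γ = refl
det-petrieDet k (suc n) A r q e γ = trans
  (∑-alt n q 1ℤ (λ y r′ → (entry k (r zero) y *ˢ petrieDet k r′ (tabulate (r ∘ suc))) γ) T γ λ j → begin
    (((-ˢ 1ˢ) ^ toℕ j) *ˢ (A zero j *ˢ det seriesRing n (minor j))) γ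
      ≡⟨ *ˢ-cong {g = A zero j *ˢ det seriesRing n (minor j)} (-1ˢ^ (toℕ j)) (λ _ → refl) γ ⟩
    ((λ γ → sgn (toℕ j) *ℤ 1ˢ γ) *ˢ (A zero j *ˢ det seriesRing n (minor j))) γ
      ≡⟨ trans (*ˢ-scaleˡ (sgn (toℕ j)) 1ˢ _ γ) (cong (sgn (toℕ j) *ℤ_) (trans (*ˢ-identityˡ _ γ)
           (*ˢ-cong (λ α → cong (λ f → f α) (e zero j))
             (det-petrieDet k n (minor j) (r ∘ suc) (q ∘ punchIn j) (λ i s → e (suc i) (punchIn j s))) γ))) ⟩
    sgn (toℕ j) *ℤ (entry k (r zero) (q j) *ˢ petrieDet k (tabulate (q ∘ punchIn j)) (tabulate (r ∘ suc))) γ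
      ≡⟨ ℤₚ.*-identityˡ _ ⟨
    1ℤ *ℤ (sgn (toℕ j) *ℤ (entry k (r zero) (q j) *ˢ petrieDet k (tabulate (q ∘ punchIn j)) (tabulate (r ∘ suc))) γ) ∎)
  (ℤₚ.*-identityˡ _)
  where
  minor : Fin (suc n) → Fin n → Fin n → Series
  minor j i s = A (suc i) (punchIn j s)
  T : Fin (suc n) → Series
  T j = ((-ˢ 1ˢ) ^ toℕ j) *ˢ (A zero j *ˢ det seriesRing n (minor j))

tabulate-β : ∀ ν → tabulate (λ i → lookup ν i + (length ν ∸ suc (toℕ i))) ≡ β ν
tabulate-β []      = refl
tabulate-β (x ∷ ν) = cong (x + length ν ∷_) (tabulate-β ν)

tabulate-downFrom : ∀ n → tabulate (λ (j : Fin n) → n ∸ suc (toℕ j)) ≡ downFrom n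
tabulate-downFrom zero    = refl
tabulate-downFrom (suc n) = cong (n ∷_) (tabulate-downFrom n)

-- Counting rows and columns from the end makes both labels natural numbers: a β-number for the row
-- and an element of `downFrom n` for the column.
jacobi-trudi-index : ∀ n a (i j : Fin n) →
  pos a -ℤ pos (toℕ i) +ℤ pos (toℕ j) ≡ (a + (n ∸ suc (toℕ i))) ⊖ (n ∸ suc (toℕ j))
jacobi-trudi-index n a i j = begin
  pos a -ℤ pos (toℕ i) +ℤ pos (toℕ j)
    ≡⟨ lem (pos a) (pos (toℕ i)) (pos (toℕ j)) (pos i′) (pos j′) total ⟩
  pos a +ℤ pos i′ -ℤ pos j′
    ≡⟨ cong (_-ℤ pos j′) (ℤₚ.pos-+ a i′) ⟨
  pos (a + i′) -ℤ pos j′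
    ≡⟨ ℤₚ.m-n≡m⊖n (a + i′) j′ ⟩
  (a + i′) ⊖ j′ ∎
  where
  i′ j′ : ℕ
  i′ = n ∸ suc (toℕ i)
  j′ = n ∸ suc (toℕ j)
  total : pos (toℕ i) +ℤ pos i′ ≡ pos (toℕ j) +ℤ pos j′
  total = trans (sym (ℤₚ.pos-+ (toℕ i) i′)) (trans (cong pos (ℕₚ.suc-injective
    (trans (ℕₚ.m+[n∸m]≡n (Finₚ.toℕ<n i)) (sym (ℕₚ.m+[n∸m]≡n (Finₚ.toℕ<n j)))))) (ℤₚ.pos-+ (toℕ j) j′))
  lem : ∀ a i j i′ j′ → i +ℤ i′ ≡ j +ℤ j′ → a -ℤ i +ℤ j ≡ a +ℤ i′ -ℤ j′
  lem a i j i′ j′ e = begin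
    a -ℤ i +ℤ j                            ≡⟨ lem₁ a i j j′ ⟩
    a -ℤ i -ℤ j′ +ℤ (j +ℤ j′)              ≡⟨ cong (a -ℤ i -ℤ j′ +ℤ_) e ⟨
    a -ℤ i -ℤ j′ +ℤ (i +ℤ i′)              ≡⟨ lem₂ a i i′ j′ ⟩
    a +ℤ i′ -ℤ j′                          ∎
    where
    lem₁ : ∀ a i j j′ → a -ℤ i +ℤ j ≡ a -ℤ i -ℤ j′ +ℤ (j +ℤ j′)
    lem₁ = solve-∀
    lem₂ : ∀ a i i′ j′ → a -ℤ i -ℤ j′ +ℤ (i +ℤ i′) ≡ a +ℤ i′ -ℤ j′
    lem₂ = solve-∀

modularSchur-E : ∀ k ν γ → modularSchur k ν γ ≡ E (below k) (κ-det (downFrom (length ν))) γ (β ν)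
modularSchur-E k ν γ = begin
  modularSchur k ν γ
    ≡⟨ det-petrieDet k (length ν) _ _ _ (λ i j → cong (petrieℤ k) (jacobi-trudi-index (length ν) (lookup ν i) i j)) γ ⟩
  petrieDet k (tabulate λ j → length ν ∸ suc (toℕ j)) (tabulate λ i → lookup ν i + (length ν ∸ suc (toℕ i))) γ
    ≡⟨ cong₂ (λ q b → petrieDet k q b γ) (tabulate-downFrom (length ν)) (tabulate-β ν) ⟩
  petrieDet k (downFrom (length ν)) (β ν) γ
    ≡⟨ petrieDet-E k (downFrom (length ν)) γ (β ν) ⟩
  E (below k) (κ-det (downFrom (length ν))) γ (β ν) ∎

-- The leading term of the power sum operator

sh-< : ∀ {i x} g → x < i → sh i x g ≡ 0ℤ
sh-< {suc i} {zero}  g _         = refl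
sh-< {suc i} {suc x} g (s≤s x<i) = sh-< g x<i

sh-≥ : ∀ {i x} g → i ≤ x → sh i x g ≡ g (x ∸ i)
sh-≥ {zero}          g _         = refl
sh-≥ {suc i} {suc x} g (s≤s i≤x) = sh-≥ g i≤x

StrictlyDecreasing : List ℕ → Set
StrictlyDecreasing []      = ⊤
StrictlyDecreasing (x ∷ v) = All (_< x) v × StrictlyDecreasing v

infix 4 _≺_
data _≺_ : List ℕ → List ℕ → Set where
  here  : ∀ {x y u v} → x < y → length u ≡ length v → x ∷ u ≺ y ∷ v
  there : ∀ {x u v} → u ≺ v → x ∷ u ≺ x ∷ v

≺-length : ∀ {u v} → u ≺ v → length u ≡ length v
≺-length (here _ e) = cong suc e
≺-length (there p)  = cong suc (≺-length p)

≺-bounded : ∀ {u v N} → u ≺ v → StrictlyDecreasing u → All (_< N) v → All (_< N) u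
≺-bounded (here x<y _) (u<x , _) (y<N ∷ _) = ℕₚ.<-trans x<y y<N ∷ All.map (λ z<x → ℕₚ.<-trans z<x (ℕₚ.<-trans x<y y<N)) u<x
≺-bounded (there p)    (_ , su)  (x<N ∷ v<N) = x<N ∷ ≺-bounded p su v<N

alternating-∈ : ∀ {f} → Alternating f → ∀ {y s} → y ∈ s → f (y ∷ s) ≡ 0ℤ
alternating-∈ {f} af {y} {_ ∷ s} (here refl) = alternating-repeat {f} af [] y s
alternating-∈ {f} af {y} {z ∷ s} (there y∈)  =
  trans (af [] y z s) (cong -ℤ_ (alternating-∈ {λ d → f (z ∷ d)} (alternating-∷ {f} z af) y∈))

record SignedSort (y : ℕ) (s : List ℕ) : Set where
  field
    sign     : ℤ
    sorted   : List ℕ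
    unit     : ∣ sign ∣ ≡ 1
    strict   : StrictlyDecreasing sorted
    bounded  : ∀ {N} → y < N → All (_< N) s → All (_< N) sorted
    length≡  : length sorted ≡ suc (length s)
    value    : ∀ {f} → Alternating f → f (y ∷ s) ≡ sign *ℤ f sorted

signedSort : ∀ y s → StrictlyDecreasing s → y ∉ s → SignedSort y s
signedSort y [] _ _ = record
  { sign = 1ℤ ; sorted = y ∷ [] ; unit = refl ; strict = [] , tt ; bounded = λ y<N _ → y<N ∷ []
  ; length≡ = refl ; value = λ _ → sym (ℤₚ.*-identityˡ _) }
signedSort y (z ∷ t) (t<z , st) y∉ with ℕₚ.<-cmp z y
... | tri< z<y _ _ = record
  { sign = 1ℤ ; sorted = y ∷ z ∷ t ; unit = refl
  ; strict = z<y ∷ All.map (λ x<z → ℕₚ.<-trans x<z z<y) t<z , t<z , st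
  ; bounded = λ y<N s<N → y<N ∷ s<N ; length≡ = refl ; value = λ _ → sym (ℤₚ.*-identityˡ _) }
... | tri≈ _ refl _ = contradiction (here refl) y∉
... | tri> _ _ y<z = record
  { sign = -ℤ sign ; sorted = z ∷ sorted ; unit = trans (ℤₚ.∣-i∣≡∣i∣ sign) unit
  ; strict = bounded y<z t<z , strict
  ; bounded = λ { y<N (z<N ∷ t<N) → z<N ∷ bounded y<N t<N } ; length≡ = cong suc length≡
  ; value = λ {f} af → trans (af [] y z t) (trans (cong -ℤ_ (value {λ d → f (z ∷ d)} (alternating-∷ {f} z af)))
      (ℤₚ.neg-distribˡ-* sign (f (z ∷ sorted)))) }
  where open SignedSort (signedSort y t st (λ y∈ → y∉ (there y∈)))

-- Only later entries can equal x ∸ k, because lists of β-numbers are decreasing.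
Irreducible : ℕ → List ℕ → Set
Irreducible k []      = ⊤
Irreducible k (x ∷ v) = (k ≤ x → x ∸ k ∈ v) × Irreducible k v

P-irreducible : ∀ k b {f} → Alternating f → Irreducible k b → P k f b ≡ 0ℤ
P-irreducible k []      af _            = refl
P-irreducible k (x ∷ v) {f} af (x-k∈v , iv) =
  cong₂ _+ℤ_ lowered (P-irreducible k v (alternating-∷ {f} x af) iv)
  where
  lowered : sh k x (λ y → f (y ∷ v)) ≡ 0ℤ
  lowered with k ≤? x
  ... | yes k≤x = trans (sh-≥ _ k≤x) (alternating-∈ {f} af (x-k∈v k≤x))
  ... | no k≰x  = sh-< _ (ℕₚ.≰⇒> k≰x)

-- The lexicographically largest sorted result of lowering an entry by k: it comes
-- from the last entry that can be lowered.
record LeadingTerm (k : ℕ) (b : List ℕ) : Set where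
  field
    sign     : ℤ
    leader   : List ℕ
    unit     : ∣ sign ∣ ≡ 1
    strict   : StrictlyDecreasing leader
    bounded  : ∀ {N} → All (_< N) b → All (_< N) leader
    length≡  : length leader ≡ length b
    value    : ∀ {f} → Alternating f → (∀ u → StrictlyDecreasing u → u ≺ leader → f u ≡ 0ℤ) →
               P k f b ≡ sign *ℤ f leader

-- If lowering some later entry survives, keeping `x` in front wins: lowering `x` leaves only
-- entries below `x`, so its sorted result is smaller or it vanishes by repetition. If `v` is
-- irreducible, lowering `x` is the only term that can survive.
leadingTerm : ∀ k → 0 < k → ∀ b → StrictlyDecreasing b → Irreducible k b ⊎ LeadingTerm k b
leadingTerm k 0<k [] _ = inj₁ tt
leadingTerm k 0<k (x ∷ v) (v<x , sv) with leadingTerm k 0<k v sv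
... | inj₂ lt = inj₂ (record
  { sign = sign ; leader = x ∷ leader ; unit = unit ; strict = bounded v<x , strict
  ; bounded = λ { (x<N ∷ v<N) → x<N ∷ bounded v<N } ; length≡ = cong suc length≡
  ; value = λ {f} af vanish → trans (cong₂ _+ℤ_ (lowered {f} af vanish)
      (value (alternating-∷ {f} x af) λ u su u≺ → vanish (x ∷ u) (≺-bounded u≺ su (bounded v<x) , su) (there u≺)))
      (ℤₚ.+-identityˡ _) })
  where
  open LeadingTerm lt

  below-leader : ∀ {s} → All (_< x) s → length s ≡ suc (length v) → s ≺ x ∷ leader
  below-leader (y<x ∷ _) e = here y<x (trans (ℕₚ.suc-injective e) (sym length≡))

  lowered : ∀ {f} → Alternating f → (∀ u → StrictlyDecreasing u → u ≺ x ∷ leader → f u ≡ 0ℤ) →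
    sh k x (λ y → f (y ∷ v)) ≡ 0ℤ
  lowered {f} af vanish with k ≤? x
  ... | no k≰x  = sh-< _ (ℕₚ.≰⇒> k≰x)
  ... | yes k≤x with (x ∸ k) ∈? v
  ... | yes x-k∈v = trans (sh-≥ _ k≤x) (alternating-∈ {f} af x-k∈v)
  ... | no x-k∉v  = trans (sh-≥ _ k≤x) (trans (S.value {f} af) (trans
          (cong (S.sign *ℤ_) (vanish S.sorted S.strict (below-leader (S.bounded (ℕₚ.∸-monoʳ-< 0<k k≤x) v<x) S.length≡)))
          (ℤₚ.*-zeroʳ S.sign)))
    where module S = SignedSort (signedSort (x ∸ k) v sv x-k∉v)
... | inj₁ iv with k ≤? x
... | no k≰x = inj₁ ((λ k≤x → contradiction k≤x k≰x) , iv)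
... | yes k≤x with (x ∸ k) ∈? v
... | yes x-k∈v = inj₁ ((λ _ → x-k∈v) , iv)
... | no x-k∉v = inj₂ (record
  { sign = S.sign ; leader = S.sorted ; unit = S.unit ; strict = S.strict
  ; bounded = λ { (x<N ∷ v<N) → S.bounded (ℕₚ.≤-<-trans (ℕₚ.m∸n≤m x k) x<N) v<N } ; length≡ = S.length≡
  ; value = λ {f} af _ → trans (cong₂ _+ℤ_ (trans (sh-≥ _ k≤x) (S.value {f} af))
      (P-irreducible k v (alternating-∷ {f} x af) iv)) (ℤₚ.+-identityʳ _) })
  where module S = SignedSort (signedSort (x ∸ k) v sv x-k∉v)

-- Unitriangularity of the Kostka numbers

-- The smallest partition ρ for which ν / ρ is a horizontal strip.
low : List ℕ → List ℕ
low []      = []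
low (x ∷ ν) = part ν 0 ∷ low ν

low-∷ : ∀ x ν → low (x ∷ ν) ≡ ν ++ [ 0 ]
low-∷ x []      = refl
low-∷ x (y ∷ ν) = cong (y ∷_) (low-∷ y ν)

anti≤-zero : ∀ t a {F : ℕ → ℕ → ℤ} → (∀ i j → i ≤ t → i + j ≡ a → F i j ≡ 0ℤ) → anti≤ t a F ≡ 0ℤ
anti≤-zero t a {F} e = trans (anti≤-cong t a e) (zeros t a)
  where
  zeros : ∀ t a → anti≤ t a (λ _ _ → 0ℤ) ≡ 0ℤ
  zeros zero    a       = refl
  zeros (suc t) zero    = refl
  zeros (suc t) (suc a) = trans (ℤₚ.+-identityˡ _) (zeros t a)

anti≤-top : ∀ t z {F : ℕ → ℕ → ℤ} → (∀ i j → z < j → F i j ≡ 0ℤ) → anti≤ t (t + z) F ≡ F t z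
anti≤-top zero    z e = refl
anti≤-top (suc t) z e = trans (cong₂ _+ℤ_ (e 0 (suc (t + z)) (s≤s (ℕₚ.m≤n+m z t)))
  (anti≤-top t z λ i → e (suc i))) (ℤₚ.+-identityˡ _)

-- A horizontal strip has at most one cell in each of the `ν₁` columns.
strip-large : ∀ g ν → Decreasing ν → ∀ a → part ν 0 < a → strip g ν a ≡ 0ℤ
strip-large g []      _          (suc a) _ = refl
strip-large g (x ∷ ν) (ν₀≤x , dν) a x<a = subst (λ x → x < a → strip g (x ∷ ν) a ≡ 0ℤ) (ℕₚ.m∸n+n≡m ν₀≤x)
  (λ t+z<a → trans (strip-∷ g t ν a) (anti≤-zero t a λ j r j≤t j+r≡a → strip-large _ ν dν r
    (ℕₚ.+-cancelˡ-< j _ _ (ℕₚ.≤-<-trans (ℕₚ.+-monoˡ-≤ (part ν 0) j≤t) (subst (t + part ν 0 <_) (sym j+r≡a) t+z<a))))) x<a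
  where
  t : ℕ
  t = x ∸ part ν 0

-- A strip with `ν₁` cells must take the lowest cell of every column, so there is just one.
strip-low : ∀ g ν → Decreasing ν → strip g ν (part ν 0) ≡ g (low ν)
strip-low g []      _           = ℤₚ.+-identityʳ (g [])
strip-low g (x ∷ ν) (ν₀≤x , dν) = subst (λ x → strip g (x ∷ ν) x ≡ g (part ν 0 ∷ low ν)) (ℕₚ.m∸n+n≡m ν₀≤x) (begin
  strip g (t + z ∷ ν) (t + z)
    ≡⟨ strip-∷ g t ν (t + z) ⟩
  anti≤ t (t + z) (λ j r → strip (λ ρ → g (t + z ∸ j ∷ ρ)) ν r)
    ≡⟨ anti≤-top t z (λ j r → strip-large _ ν dν r) ⟩
  strip (λ ρ → g (t + z ∸ t ∷ ρ)) ν z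
    ≡⟨ strip-low _ ν dν ⟩
  g (t + z ∸ t ∷ low ν)
    ≡⟨ cong (λ y → g (y ∷ low ν)) (ℕₚ.m+n∸m≡n t z) ⟩
  g (z ∷ low ν) ∎)
  where
  z t : ℕ
  z = part ν 0
  t = x ∸ z

decreasing-∷ʳ0 : ∀ ν → Decreasing ν → Decreasing (ν ++ [ 0 ])
decreasing-∷ʳ0 []          _           = z≤n , tt
decreasing-∷ʳ0 (x ∷ [])    _           = z≤n , z≤n , tt
decreasing-∷ʳ0 (x ∷ y ∷ ν) (y≤x , dν) = y≤x , decreasing-∷ʳ0 (y ∷ ν) dν

-- Unitriangularity of the Kostka numbers.  Removing the largest part of the weight
-- first forces the strip ν / low ν, and low only deletes the first part of ν; the
-- zeros appended on the way are carried along as z.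
kostka-diagonal : ∀ μ z → All (_≡ 0) z → Decreasing (μ ++ z) → pos (countTableaux (μ ++ z) μ) ≡ 1ℤ
kostka-diagonal [] z z≡0 _ = cong (λ b → pos (if b then 1 else 0)) (dec-true (sum z ≟ 0) (sum-zeros z≡0))
  where
  sum-zeros : ∀ {z} → All (_≡ 0) z → sum z ≡ 0
  sum-zeros []            = refl
  sum-zeros (refl ∷ z≡0) = sum-zeros z≡0
kostka-diagonal (x ∷ μ) z z≡0 d@(_ , dμ) = begin
  pos (countTableaux (x ∷ μ ++ z) (x ∷ μ))               ≡⟨ countTableaux-∷ (x ∷ μ ++ z) x μ ⟩
  strip (λ ρ → pos (countTableaux ρ μ)) (x ∷ μ ++ z) x   ≡⟨ strip-low _ (x ∷ μ ++ z) d ⟩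
  pos (countTableaux (low (x ∷ μ ++ z)) μ)
    ≡⟨ cong (λ ρ → pos (countTableaux ρ μ)) (trans (low-∷ x (μ ++ z)) (Listₚ.++-assoc μ z [ 0 ])) ⟩
  pos (countTableaux (μ ++ z ++ [ 0 ]) μ)
    ≡⟨ kostka-diagonal μ (z ++ [ 0 ]) (Allₚ.++⁺ z≡0 (refl ∷ []))
         (subst Decreasing (Listₚ.++-assoc μ z [ 0 ]) (decreasing-∷ʳ0 (μ ++ z) dμ)) ⟩
  1ℤ ∎

-- Equal leading parts force the maximal strip and are removed together; at the first difference the
-- weight asks for more cells than there are columns.
kostka-below : ∀ {ν μ} → ν ≺ μ → ∀ z → Decreasing (ν ++ z) → pos (countTableaux (ν ++ z) μ) ≡ 0ℤ
kostka-below {x ∷ ν} {y ∷ μ} (here x<y _) z d =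
  trans (countTableaux-∷ (x ∷ ν ++ z) y μ) (strip-large _ (x ∷ ν ++ z) d y x<y)
kostka-below {x ∷ ν} {_ ∷ μ} (there ν≺μ) z d@(_ , dν) = begin
  pos (countTableaux (x ∷ ν ++ z) (x ∷ μ))               ≡⟨ countTableaux-∷ (x ∷ ν ++ z) x μ ⟩
  strip (λ ρ → pos (countTableaux ρ μ)) (x ∷ ν ++ z) x   ≡⟨ strip-low _ (x ∷ ν ++ z) d ⟩
  pos (countTableaux (low (x ∷ ν ++ z)) μ)
    ≡⟨ cong (λ ρ → pos (countTableaux ρ μ)) (trans (low-∷ x (ν ++ z)) (Listₚ.++-assoc ν z [ 0 ])) ⟩
  pos (countTableaux (ν ++ z ++ [ 0 ]) μ)
    ≡⟨ kostka-below ν≺μ (z ++ [ 0 ]) (subst Decreasing (Listₚ.++-assoc ν z [ 0 ]) (decreasing-∷ʳ0 (ν ++ z) dν)) ⟩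
  0ℤ ∎

-- Strictly decreasing vectors as β-numbers

length-β : ∀ ν → length (β ν) ≡ length ν
length-β []      = refl
length-β (x ∷ ν) = cong suc (length-β ν)

β-bounded : ∀ ν {N} → Decreasing ν → part ν 0 + length ν ≤ N → All (_< N) (β ν)
β-bounded []      _          _ = []
β-bounded (x ∷ ν) {N} (ν₀≤x , dν) le = x+ℓ<N ∷ β-bounded ν dν (ℕₚ.≤-trans (ℕₚ.+-monoˡ-≤ (length ν) ν₀≤x) (ℕₚ.<⇒≤ x+ℓ<N))
  where
  x+ℓ<N : x + length ν < N
  x+ℓ<N = subst (_≤ N) (ℕₚ.+-suc x (length ν)) le

β-strict : ∀ ν → Decreasing ν → StrictlyDecreasing (β ν)
β-strict []      _           = tt
β-strict (x ∷ ν) (ν₀≤x , dν) = β-bounded ν dν (ℕₚ.+-monoˡ-≤ (length ν) ν₀≤x) , β-strict ν dν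

β-surjective : ∀ u → StrictlyDecreasing u → ∃ λ ν → Decreasing ν × β ν ≡ u
β-surjective []      _ = [] , tt , refl
β-surjective (x ∷ u) (u<x , su) with β-surjective u su
... | ν , dν , refl = x ∸ length ν ∷ ν , (ℕₚ.m+n≤o⇒m≤o∸n (part ν 0) (ν₀+ℓ≤x ν u<x) , dν) ,
    cong (_∷ β ν) (ℕₚ.m∸n+n≡m (ℕₚ.≤-trans (ℕₚ.m≤n+m (length ν) (part ν 0)) (ν₀+ℓ≤x ν u<x)))
  where
  ν₀+ℓ≤x : ∀ ν → All (_< x) (β ν) → part ν 0 + length ν ≤ x
  ν₀+ℓ≤x []      _         = z≤n
  ν₀+ℓ≤x (y ∷ ν) (y+ℓ<x ∷ _) = subst (_≤ x) (sym (ℕₚ.+-suc y (length ν))) y+ℓ<x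

≺-β : ∀ ν μ → β ν ≺ β μ → ν ≺ μ
≺-β []      μ       ()
≺-β (x ∷ ν) []      ()
≺-β (x ∷ ν) (y ∷ μ) p = go p refl refl
  where
  lengths : length (β ν) ≡ length (β μ) → length ν ≡ length μ
  lengths e = trans (sym (length-β ν)) (trans e (length-β μ))
  go : ∀ {u v} → u ≺ v → u ≡ β (x ∷ ν) → v ≡ β (y ∷ μ) → x ∷ ν ≺ y ∷ μ
  go (here lt e) refl refl = here (ℕₚ.+-cancelʳ-< (length μ) x y (subst (λ ℓ → x + ℓ < y + length μ) (lengths e) lt)) (lengths e)
  go (there q) eu ev with Listₚ.∷-injective eu | Listₚ.∷-injective ev
  ... | ex , refl | ey , refl with ℕₚ.+-cancelʳ-≡ (length μ) x y
          (trans (cong (x +_) (sym (lengths (≺-length q)))) (trans (sym ex) ey))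
  ... | refl = there (≺-β ν μ q)

-- Ribbons and β-numbers

-- Hook y w v: in the rows v of ν and w of ρ following a row that ends in y in ρ,
-- the ribbon ν / ρ continues for some rows and then stops.
data Hook : ℕ → List ℕ → List ℕ → Set where
  stop : ∀ {y v} → Hook y v v
  step : ∀ {y z w v} → Hook z w v → Hook y (z ∷ w) (suc y ∷ v)

data Ribbon : List ℕ → List ℕ → Set where
  skip  : ∀ {x v w} → Ribbon v w → Ribbon (x ∷ v) (x ∷ w)
  start : ∀ {x y v w} → Hook y w v → Ribbon (x ∷ v) (y ∷ w)

hook-length : ∀ {y w v} → Hook y w v → length w ≡ length v
hook-length stop     = refl
hook-length (step h) = cong suc (hook-length h)

-- Removing a k-ribbon that starts in the row of x lowers its entry of β by k.
hook-lowered : ∀ {k y w v} → Hook y w v → ∀ x → Decreasing (y ∷ w) → x + sum v ≡ k + (y + sum w) →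
  ∃ λ z → x + length v ≡ k + z × z ≤ y + length w × z ∉ β v
hook-lowered {k} {y} {v} stop x (v₀≤y , dv) e =
  y + length v , trans (cong (_+ length v) x≡k+y) (ℕₚ.+-assoc k y (length v)) , ℕₚ.≤-refl ,
  λ z∈ → ℕₚ.<-irrefl refl (All.lookup (β-bounded v dv (ℕₚ.+-monoˡ-≤ (length v) v₀≤y)) z∈)
  where
  x≡k+y : x ≡ k + y
  x≡k+y = ℕₚ.+-cancelʳ-≡ (sum v) x (k + y) (trans e (sym (ℕₚ.+-assoc k y (sum v))))
-- Cancelling the row `suc y` of `ν` against the row `y` of `ρ` leaves a surplus of one cell. Moving
-- it to `x` compensates for the row lost in `length`, so the β-number of the top row is unchanged.
hook-lowered {k} {y} {z ∷ w} {_ ∷ v} (step h) x (z≤y , dw) e with hook-lowered h (suc x) dw e′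
  where
  e′ : suc x + sum v ≡ k + (z + sum w)
  e′ = ℕₚ.+-cancelˡ-≡ y _ _ (begin
    y + (suc x + sum v)            ≡⟨ solve 3 (λ x y s → y :+ ((con 1 :+ x) :+ s) := x :+ ((con 1 :+ y) :+ s)) refl x y (sum v) ⟩
    x + (suc y + sum v)            ≡⟨ e ⟩
    k + (y + (z + sum w))          ≡⟨ solve 3 (λ k y s → k :+ (y :+ s) := y :+ (k :+ s)) refl k y (z + sum w) ⟩
    y + (k + (z + sum w))          ∎)
... | m , x≡ , m≤ , m∉ = m , trans (ℕₚ.+-suc x (length v)) x≡ ,
    ℕₚ.≤-trans m≤ (ℕₚ.+-mono-≤ z≤y (ℕₚ.n≤1+n (length w))) , λ
    { (here m≡)  → ℕₚ.<-irrefl m≡ (s≤s (ℕₚ.≤-trans m≤ (ℕₚ.+-mono-≤ z≤y (ℕₚ.≤-reflexive (hook-length h)))))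
    ; (there m∈) → m∉ m∈ }

-- Rows above the ribbon are skipped. In its top row, the β-number lowered by `k` differs from all
-- later ones by `hook-lowered`.
ribbon⇒¬irreducible : ∀ {k v w} → Ribbon v w → Decreasing w → sum v ≡ k + sum w → ¬ Irreducible k (β v)
ribbon⇒¬irreducible {k} {x ∷ v} {_ ∷ w} (skip r) (_ , dw) e (_ , iv) =
  ribbon⇒¬irreducible r dw (ℕₚ.+-cancelˡ-≡ x _ _ (trans e
    (solve 3 (λ k x s → k :+ (x :+ s) := x :+ (k :+ s)) refl k x (sum w)))) iv
ribbon⇒¬irreducible {k} {x ∷ v} (start h) dw e (lowered , _) with hook-lowered h x dw e
... | z , x≡ , _ , z∉ = z∉ (subst (_∈ β v) (trans (cong (_∸ k) x≡) (ℕₚ.m+n∸m≡n k z))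
    (lowered (subst (k ≤_) (sym x≡) (ℕₚ.m≤m+n k z))))

differ : ∀ n (l r : ℕ → ℕ) → (∀ i → r i ≤ l i) → applyUpTo r n ≡ applyUpTo l n ⊎ ∃ λ j → r j < l j
differ zero    l r r≤l = inj₁ refl
differ (suc n) l r r≤l with r 0 ≟ l 0 | differ n (l ∘ suc) (r ∘ suc) (r≤l ∘ suc)
... | no r≢l | _              = inj₂ (0 , ℕₚ.≤∧≢⇒< (r≤l 0) r≢l)
... | yes _  | inj₂ (j , lt)  = inj₂ (suc j , lt)
... | yes e  | inj₁ e′        = inj₁ (cong₂ _∷_ e e′)

-- The ribbon goes on below the current row as long as some later row still differs, and then the
-- chain condition fixes the next row of `l`.
hook : ∀ n (l r : ℕ → ℕ) → (∀ i → r i ≤ l i) → (∀ s j → r j < l j → s < j → l (suc s) ≡ suc (r s)) →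
  Hook (r 0) (applyUpTo (r ∘ suc) n) (applyUpTo (l ∘ suc) n)
hook zero    l r r≤l chain = stop
hook (suc n) l r r≤l chain with differ (suc n) (l ∘ suc) (r ∘ suc) (r≤l ∘ suc)
... | inj₁ e        = subst (Hook (r 0) (applyUpTo (r ∘ suc) (suc n))) e stop
... | inj₂ (j , lt) = subst (λ x → Hook (r 0) (applyUpTo (r ∘ suc) (suc n)) (x ∷ applyUpTo (λ i → l (suc (suc i))) n))
  (sym (chain 0 (suc j) lt (s≤s z≤n)))
  (step (hook n (l ∘ suc) (r ∘ suc) (r≤l ∘ suc) λ s j lt s<j → chain (suc s) (suc j) lt (s≤s s<j)))

ribbon : ∀ {k} n (l r : ℕ → ℕ) → 0 < k → (∀ i → r i ≤ l i) →
  (∀ i s j → r i < l i → r j < l j → i ≤ s → s < j → l (suc s) ≡ suc (r s)) →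
  sum (applyUpTo l n) ≡ k + sum (applyUpTo r n) → Ribbon (applyUpTo l n) (applyUpTo r n)
-- If no row differed, the two sizes would be equal, contrary to `0 < k`.
ribbon {suc k} zero    l r 0<k r≤l chain ()
ribbon {k} (suc n) l r 0<k r≤l chain e with r 0 ≟ l 0
... | no r≢l = start (hook n l r r≤l λ s j lt → chain 0 s j (ℕₚ.≤∧≢⇒< (r≤l 0) r≢l) lt z≤n)
... | yes r≡l = subst (λ x → Ribbon (x ∷ applyUpTo (l ∘ suc) n) (applyUpTo r (suc n))) r≡l
  (skip (ribbon n (l ∘ suc) (r ∘ suc) 0<k (r≤l ∘ suc)
    (λ i s j li lj i≤s s<j → chain (suc i) (suc s) (suc j) li lj (s≤s i≤s) (s≤s s<j))
    (ℕₚ.+-cancelˡ-≡ (r 0) _ _ (trans (cong (_+ sum (applyUpTo (l ∘ suc) n)) r≡l) (trans e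
      (solve 3 (λ k x s → k :+ (x :+ s) := x :+ (k :+ s)) refl k (r 0) (sum (applyUpTo (r ∘ suc) n))))))))

part-decreasing : ∀ ν → Decreasing ν → ∀ i → part ν (suc i) ≤ part ν i
part-decreasing []      _        i       = z≤n
part-decreasing (x ∷ ν) (p , dν) zero    = p
part-decreasing (x ∷ ν) (p , dν) (suc i) = part-decreasing ν dν i

applyUpTo-part : ∀ ν n → length ν ≤ n → sum (applyUpTo (part ν) n) ≡ sum ν
applyUpTo-part []      zero    _         = refl
applyUpTo-part []      (suc n) _         = applyUpTo-part [] n z≤n
applyUpTo-part (x ∷ ν) (suc n) (s≤s ℓ≤n) = cong (x +_) (applyUpTo-part ν n ℓ≤n)

applyUpTo-part-length : ∀ ν → applyUpTo (part ν) (length ν) ≡ ν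
applyUpTo-part-length []      = refl
applyUpTo-part-length (x ∷ ν) = cong (x ∷_) (applyUpTo-part-length ν)

decreasing-applyUpTo : ∀ n (r : ℕ → ℕ) → (∀ i → r (suc i) ≤ r i) → Decreasing (applyUpTo r n)
decreasing-applyUpTo zero          r d = tt
decreasing-applyUpTo (suc zero)    r d = z≤n , tt
decreasing-applyUpTo (suc (suc n)) r d = d 0 , decreasing-applyUpTo (suc n) (r ∘ suc) (d ∘ suc)

contained⇒length≤ : ∀ ρ ν → All (0 <_) ρ → (∀ i → part ρ i ≤ part ν i) → length ρ ≤ length ν
contained⇒length≤ []      ν       _           _ = z≤n
contained⇒length≤ (y ∷ ρ) []      (0<y ∷ _)   c = contradiction (c 0) (ℕₚ.<⇒≱ 0<y)
contained⇒length≤ (y ∷ ρ) (x ∷ ν) (_ ∷ 0<ρ)   c = s≤s (contained⇒length≤ ρ ν 0<ρ (c ∘ suc))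

module _ {k ν ρ} (dν : Decreasing ν) (removal : RibbonRemoval k ν ρ) where
  open RibbonRemoval removal

  private
    dρ : Decreasing ρ
    dρ = linked⇒decreasing (proj₁ isPartition)

    -- Otherwise no two consecutive cells of ν / ρ lie in the rows s and suc s.
    rows-meet : ∀ i s j → part ρ i < part ν i → part ρ j < part ν j → i ≤ s → s < j → part ρ s < part ν (suc s)
    rows-meet i s j ρᵢ<νᵢ ρⱼ<νⱼ i≤s s<j with part ρ s <? part ν (suc s)
    ... | yes lt = lt
    ... | no ≮   = contradiction
      (trans (sym (dec-true (i ≤? s) i≤s)) (trans
        (EqClosureₚ.gfold isEquivalence above same (connected (i , part ρ i) (j , part ρ j) (ℕₚ.≤-refl , ρᵢ<νᵢ) (ℕₚ.≤-refl , ρⱼ<νⱼ)))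
        (dec-false (j ≤? s) (ℕₚ.<⇒≱ s<j))))
      λ ()
      where
      -- A step between adjacent cells can change this value only by crossing from row `s` to row
      -- `suc s`. If that is impossible, connectedness puts the rows `i` and `j` on the same side.
      above : Cell → Bool
      above (a , _) = does (a ≤? s)

      same : ∀ {c d} → c ∈ ν / ρ × d ∈ ν / ρ × Next c d → above c ≡ above d
      same (_ , _ , inj₁ (refl , _)) = refl
      same {a , b} ((ρ≤b , _) , (_ , b<ν) , inj₂ (refl , refl)) with ℕₚ.<-cmp a s
      ... | tri< a<s _ _  = trans (dec-true (a ≤? s) (ℕₚ.<⇒≤ a<s)) (sym (dec-true (suc a ≤? s) a<s))
      ... | tri≈ _ refl _ = contradiction (ℕₚ.≤-<-trans ρ≤b b<ν) ≮
      ... | tri> _ _ s<a  = trans (dec-false (a ≤? s) (ℕₚ.<⇒≱ s<a))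
                              (sym (dec-false (suc a ≤? s) (ℕₚ.<⇒≱ (ℕₚ.m<n⇒m<1+n s<a))))

    -- Consecutive rows of the ribbon share exactly one column: connectedness gives one, and a
    -- second would complete a 2×2 square.
    rows-chain : ∀ i s j → part ρ i < part ν i → part ρ j < part ν j → i ≤ s → s < j → part ν (suc s) ≡ suc (part ρ s)
    rows-chain i s j ρᵢ<νᵢ ρⱼ<νⱼ i≤s s<j = ℕₚ.≤-antisym (ℕₚ.≮⇒≥ too-wide) (rows-meet i s j ρᵢ<νᵢ ρⱼ<νⱼ i≤s s<j)
      where
      too-wide : ¬ suc (part ρ s) < part ν (suc s)
      too-wide lt = no2×2 s (part ρ s)
        ( (ℕₚ.≤-refl , ℕₚ.<-≤-trans (ℕₚ.<⇒≤ lt) νₛ₊₁≤νₛ)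
        , (ℕₚ.n≤1+n _ , ℕₚ.<-≤-trans lt νₛ₊₁≤νₛ)
        , (part-decreasing ρ dρ s , ℕₚ.<⇒≤ lt)
        , (ℕₚ.m≤n⇒m≤1+n (part-decreasing ρ dρ s) , lt) )
        where
        νₛ₊₁≤νₛ : part ν (suc s) ≤ part ν s
        νₛ₊₁≤νₛ = part-decreasing ν dν s

  removal⇒¬irreducible : 0 < k → ¬ Irreducible k (β ν)
  -- `ρ` may have fewer parts than `ν`; it is padded with zeros so that both have the same number of
  -- rows.
  removal⇒¬irreducible 0<k = subst (λ v → ¬ Irreducible k (β v)) (applyUpTo-part-length ν)
    (ribbon⇒¬irreducible (ribbon ℓ (part ν) (part ρ) 0<k contained rows-chain sums)
      (decreasing-applyUpTo ℓ (part ρ) (part-decreasing ρ dρ)) sums)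
    where
    ℓ : ℕ
    ℓ = length ν
    sums : sum (applyUpTo (part ν) ℓ) ≡ k + sum (applyUpTo (part ρ) ℓ)
    sums = trans (applyUpTo-part ν ℓ ℕₚ.≤-refl) (trans size (cong (k +_)
      (sym (applyUpTo-part ρ ℓ (contained⇒length≤ ρ ν (proj₂ isPartition) contained)))))

-- The list of partitions and the Schur expansion

∈-words : ∀ {A : Set} n {xs w : List A} → All (_∈ xs) w → length w ≤ n → w ∈ words n xs
∈-words zero    {w = []} _ _ = here refl
∈-words (suc n) []           _          = here refl
∈-words (suc n) (x∈ ∷ w∈)   (s≤s ℓ≤n) = there (∈ₚ.∈-cartesianProductWith⁺ _∷_ x∈ (∈-words n w∈ ℓ≤n))

words-unique : ∀ {A : Set} n {xs : List A} → Unique xs → Unique (words n xs)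
words-unique zero    _ = [] ∷ []
words-unique (suc n) {xs} uxs =
  All.tabulate (λ w∈ []≡w → nonempty (subst (_∈ _) (sym []≡w) w∈))
  ∷ Uniqueₚ.cartesianProductWith⁺ _∷_ Listₚ.∷-injective uxs (words-unique n uxs)
  where
  nonempty : [] ∉ cartesianProductWith _∷_ xs (words n xs)
  nonempty []∈ with ∈ₚ.∈-cartesianProductWith⁻ _∷_ xs (words n xs) []∈
  ... | _ , _ , _ , _ , ()

-- The expansion sums over this list, so a repeated partition would contribute its Schur function
-- twice.
partitions-unique : ∀ n → Unique (partitions n)
partitions-unique n = Uniqueₚ.filter⁺ (_⊢? n) (words-unique n (Uniqueₚ.upTo⁺ (suc n)))

∈-partitions : ∀ {ν n} → ν ⊢ n → ν ∈ partitions n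
∈-partitions {ν} {n} ν⊢n@((_ , 0<ν) , refl) =
  ∈ₚ.∈-filter⁺ (_⊢? n) (∈-words n (All.map (∈ₚ.∈-upTo⁺ ∘ s≤s) (parts≤sum ν)) (length≤sum ν 0<ν)) ν⊢n
  where
  parts≤sum : ∀ ν → All (_≤ sum ν) ν
  parts≤sum []      = []
  parts≤sum (x ∷ ν) = ℕₚ.m≤m+n x (sum ν) ∷ All.map (λ y≤ → ℕₚ.≤-trans y≤ (ℕₚ.m≤n+m (sum ν) x)) (parts≤sum ν)
  length≤sum : ∀ ν → All (0 <_) ν → length ν ≤ sum ν
  length≤sum []      []          = z≤n
  length≤sum (x ∷ ν) (0<x ∷ 0<ν) = ℕₚ.+-mono-≤ 0<x (length≤sum ν 0<ν)

lsum-δ : ∀ (h : List ℕ → ℤ) {ν l} → Unique l → ν ∈ l → lsum (λ ρ → δ ν ρ *ℤ h ρ) l ≡ h ν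
lsum-δ h {ν} {_ ∷ l} (ν∉ ∷ _) (here refl) = trans (cong₂ _+ℤ_
  (trans (cong (λ b → (if b then 1ℤ else 0ℤ) *ℤ h ν) (dec-true (Listₚ.≡-dec _≟_ ν ν) refl)) (ℤₚ.*-identityˡ (h ν)))
  (lsum-zero l λ ρ ρ∈ → cong (λ b → (if b then 1ℤ else 0ℤ) *ℤ h ρ) (dec-false (Listₚ.≡-dec _≟_ ν ρ) (All.lookup ν∉ ρ∈))))
  (ℤₚ.+-identityʳ (h ν))
lsum-δ h {ν} {ρ ∷ l} (ρ∉ ∷ ul) (there ν∈) = trans (cong₂ _+ℤ_
  (cong (λ b → (if b then 1ℤ else 0ℤ) *ℤ h ρ) (dec-false (Listₚ.≡-dec _≟_ ν ρ) λ ν≡ρ → All.lookup ρ∉ ν∈ (sym ν≡ρ)))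
  (lsum-δ h ul ν∈)) (ℤₚ.+-identityˡ (h ν))

modularSchur≡schur : ∀ k ν → IsPartition ν → (m : List ℕ → ℤ) → IsSchurExpansion k ν m →
  (∀ ρ → ρ ⊢ sum ν → m ρ ≡ δ ν ρ) → ∀ α → modularSchur k ν α ≡ schur ν α
modularSchur≡schur k ν pν m expansion m≡δ α = begin
  modularSchur k ν α                                       ≡⟨ expansion α ⟩
  foldr _+ˢ_ 0ˢ (map (λ ρ → m ρ • schur ρ) ps) α           ≡⟨ pointwise ps ⟩
  lsum (λ ρ → m ρ *ℤ schur ρ α) ps
    ≡⟨ lsum-cong ps (λ ρ ρ∈ → cong (_*ℤ schur ρ α) (m≡δ ρ (proj₂ (∈ₚ.∈-filter⁻ (_⊢? sum ν) {xs = words (sum ν) (upTo (suc (sum ν)))} ρ∈)))) ⟩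
  lsum (λ ρ → δ ν ρ *ℤ schur ρ α) ps                       ≡⟨ lsum-δ (λ ρ → schur ρ α) (partitions-unique (sum ν)) (∈-partitions (pν , refl)) ⟩
  schur ν α                                                ∎
  where
  ps : List (List ℕ)
  ps = partitions (sum ν)
  pointwise : ∀ l → foldr _+ˢ_ 0ˢ (map (λ ρ → m ρ • schur ρ) l) α ≡ lsum (λ ρ → m ρ *ℤ schur ρ α) l
  pointwise []      = refl
  pointwise (ρ ∷ l) = cong (m ρ *ℤ schur ρ α +ℤ_) (pointwise l)

-- Divisibility against a unit leading coefficient

1-k-nonunit : ∀ {k} → 2 < k → ∀ i → ∣ (1ℤ -ℤ pos k) *ℤ i ∣ ≢ 1
1-k-nonunit {suc (suc (suc k))} _ i e with
  ℕₚ.m*n≡1⇒m≡1 ∣ 1ℤ -ℤ pos (3 + k) ∣ ∣ i ∣ (trans (sym (ℤₚ.abs-* (1ℤ -ℤ pos (3 + k)) i)) e)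
... | ()
1-k-nonunit {suc zero}       (s≤s ())
1-k-nonunit {suc (suc zero)} (s≤s (s≤s ()))

modularSchur≡schur⇒irreducible : ∀ {k} → 2 < k → ∀ ν → Decreasing ν →
  (∀ α → modularSchur k ν α ≡ schur ν α) → Irreducible k (β ν)
modularSchur≡schur⇒irreducible {k} 2<k ν dν same with leadingTerm k (ℕₚ.≤-<-trans z≤n 2<k) (β ν) (β-strict ν dν)
... | inj₁ irreducible = irreducible
... | inj₂ lt with β-surjective (LeadingTerm.leader lt) (LeadingTerm.strict lt)
... | μ , dμ , βμ≡leader = contradiction ∣divisible∣ (1-k-nonunit 2<k (P k (E (below k) e μ) (β ν)))
  where
  open LeadingTerm lt

  e : List ℕ → ℤ
  e = κ-det (downFrom (length ν))

  0<k : 0 < k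
  0<k = ℕₚ.≤-<-trans z≤n 2<k

  coefficients : ∀ γ → E (below k) e γ (β ν) ≡ E 𝟙 e γ (β ν)
  coefficients γ = begin
    E (below k) e γ (β ν)            ≡⟨ modularSchur-E k ν γ ⟨
    modularSchur k ν γ               ≡⟨ same γ ⟩
    schur ν γ                        ≡⟨ jacobi-trudi (reverse γ) ν dν ⟩
    E 𝟙 e (reverse γ) (β ν)          ≡⟨ E-reverse 𝟙 e γ (β ν) ⟩
    E 𝟙 e γ (β ν)                    ∎

  length-μ : length μ ≡ length ν
  length-μ = trans (sym (length-β μ)) (trans (cong length βμ≡leader) (trans length≡ (length-β ν)))

  kostka : ∀ ρ → Decreasing ρ → length ρ ≡ length ν → E 𝟙 e μ (β ρ) ≡ pos (countTableaux ρ μ)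
  kostka ρ dρ ℓ = trans (cong (λ n → E 𝟙 (κ-det (downFrom n)) μ (β ρ)) (sym ℓ)) (sym (jacobi-trudi μ ρ dρ))

  -- Such a `u` consists of the β-numbers of some `ρ ≺ μ`, and there is no tableau of shape `ρ` and
  -- weight `μ`. At weight `μ` only the leading term is left.
  vanish : ∀ u → StrictlyDecreasing u → u ≺ leader → E 𝟙 e μ u ≡ 0ℤ
  vanish u su u≺ with β-surjective u su
  ... | ρ , dρ , refl = trans (kostka ρ dρ (trans (≺-length ρ≺μ) length-μ))
    (trans (cong (λ ρ → pos (countTableaux ρ μ)) (sym (Listₚ.++-identityʳ ρ)))
      (kostka-below ρ≺μ [] (subst Decreasing (sym (Listₚ.++-identityʳ ρ)) dρ)))
    where
    ρ≺μ : ρ ≺ μ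
    ρ≺μ = ≺-β ρ μ (subst (β ρ ≺_) (sym βμ≡leader) u≺)

  leading-coefficient : E 𝟙 e μ leader ≡ 1ℤ
  leading-coefficient = trans (cong (E 𝟙 e μ) (sym βμ≡leader)) (trans (kostka μ dμ length-μ)
    (trans (cong (λ ρ → pos (countTableaux ρ μ)) (sym (Listₚ.++-identityʳ μ)))
      (kostka-diagonal μ [] [] (subst Decreasing (sym (Listₚ.++-identityʳ μ)) dμ))))

  ∣divisible∣ : ∣ (1ℤ -ℤ pos k) *ℤ P k (E (below k) e μ) (β ν) ∣ ≡ 1
  ∣divisible∣ = begin
    ∣ (1ℤ -ℤ pos k) *ℤ P k (E (below k) e μ) (β ν) ∣
      ≡⟨ cong ∣_∣ (petrie-power-sum k 0<k e (β ν) coefficients μ) ⟩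
    ∣ P k (E 𝟙 e μ) (β ν) ∣
      ≡⟨ cong ∣_∣ (value (E-alternating 𝟙 μ (κ-det-alternating (downFrom (length ν)))) vanish) ⟩
    ∣ sign *ℤ E 𝟙 e μ leader ∣
      ≡⟨ cong ∣_∣ (trans (cong (sign *ℤ_) leading-coefficient) (ℤₚ.*-identityʳ sign)) ⟩
    ∣ sign ∣
      ≡⟨ unit ⟩
    1 ∎

odd-prime>2 : ∀ {k} → Prime k → ¬ (2 ∣ k) → 2 < k
odd-prime>2 {k} (prime {{nt}} _) odd = ℕₚ.≤∧≢⇒< (nonTrivial⇒n>1 k {{nt}}) λ { refl → odd (divides 1 refl) }

theorem6 : (k : ℕ) → Prime k → ¬ (2 ∣ k) →
    (lam : List ℕ) → IsPartition lam →
    (m : List ℕ → ℤ) → IsSchurExpansion k lam m →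
    (∀ ν → ν ⊢ sum lam → m ν ≡ δ lam ν) →
    IsCore k lam
theorem6 k pk odd lam plam m expansion m≡δ ρ removal = removal⇒¬irreducible dlam removal (ℕₚ.≤-<-trans z≤n 2<k)
  (modularSchur≡schur⇒irreducible 2<k lam dlam (modularSchur≡schur k lam plam m expansion m≡δ))
  where
  dlam : Decreasing lam
  dlam = linked⇒decreasing (proj₁ plam)
  2<k : 2 < k
  2<k = odd-prime>2 pk odd
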